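{- For all constants $\varepsilon>0$ and $K>0$ there exist constants $\gamma,\alpha>0$ and $n_0$ such that for all $n\geq n_0$ the following holds. Let $k\geq 2$ and $h\geq1$ be integers with $k/h\leq K\, n^{1/4-\varepsilon}$, and let $\mathbf{c}=(c_1,\dots,c_k)$ be an initial $k$-color configuration on $n$ nodes with $\max\{c_j : j=1,\dots,k\}\leq \frac{3n}{2k}$. Let $\mathbf{C}^{(t)}$ be the random configuration at round $t$ of the $h$-plurality protocol started from $\mathbf{C}^{(0)}=\mathbf{c}$, and let $\tau=\inf\{t\in\mathbb{N}: \mathbf{C}^{(t)}\text{ is monochromatic}\}$. Then $\tau\geq\gamma\,k/h^2$ with probability at least $1-n^{ -\alpha}$. (That is, $\tau=\Omega(k/h^2)$ with high probability.)
   Context: A $k$-color configuration on $n$ nodes is a $k$-tuple $\mathbf{c}=(c_1,\dots,c_k)$ of non-negative integers with $\sum_{j} c_j = n$, where $c_j$ is the number of nodes with color $j\in[k]=\{1,\dots,k\}$. It is monochromatic if $c_j=n$ for some $j\in[k]$. $h$-plurality protocol (synchronous rounds): at every round, every node, independently of the others, picks $h$ nodes uniformly at random (including itself and with repetitions) and recolors itself according to the plurality of the colors it sees, breaking ties uniformly at random. All nodes update simultaneously, using the colors at the beginning of the round. -}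

module Defs where

open import Data.Bool.Base using (if_then_else_)
open import Data.Fin.Base using (Fin; toℕ)
import Data.Fin.Properties as Fin
open import Data.Integer.Base using (ℤ; +_; -[1+_])
open import Data.List.Base as List
  using (List; []; _∷_; allFin; filter; findIndex; length)
open import Data.List.Extrema.Nat using (argmax; f[xs]≤f[argmax])
open import Data.List.Membership.Propositional.Properties
  using (∈-allFin; ∈-filter⁺; ∈-length)
import Data.List.Relation.Unary.All as ListAll
open import Data.Maybe.Base as Maybe using (Maybe)
import Data.Maybe.Relation.Unary.All as MaybeAll
open import Data.Nat.Base as ℕ using (ℕ; zero; suc; NonZero; _⊔_)
import Data.Nat.Properties as ℕ
open import Data.Product.Base using (∃-syntax)
open import Data.Rational.Base as ℚ
  using (ℚ; 0ℚ; 1ℚ; _/_; _*_; _≤_; ↥_; ↧ₙ_; +-0-rawMonoid; +-*-rawSemiring)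
import Data.Rational.Properties as ℚ
open import Algebra.Definitions.RawMonoid +-0-rawMonoid using (sum)
open import Algebra.Definitions.RawSemiring +-*-rawSemiring using (_^_)
open import Data.Vec.Base as Vec using (Vec; []; _∷_; count; lookup; tabulate)
open import Relation.Binary.PropositionalEquality using (_≡_)
open import Relation.Nullary.Decidable using (does)
open import Relation.Unary using (Pred; Decidable)
open import Level using (0ℓ)

private variable
  A B : Set
  h k n : ℕ

-- Finite randomised computations: each `uniform m` node draws a fresh
-- uniform element of Fin m, independent of all earlier draws.

data Rand (A : Set) : Set where
  pure    : A → Rand A
  uniform : (m : ℕ) .{{_ : NonZero m}} → (Fin m → Rand A) → Rand A

infixl 1 _>>=_
_>>=_ : Rand A → (A → Rand B) → Rand B
pure a      >>= g = g a
uniform m f >>= g = uniform m (λ i → f i >>= g)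

-- The components are drawn independently.
independently : (n : ℕ) → Rand A → Rand (Vec A n)
independently zero    r = pure []
independently (suc n) r =
  r >>= λ a → independently n r >>= λ as → pure (a ∷ as)

uniformFrom : (xs : List A) .{{_ : NonZero (length xs)}} → Rand A
uniformFrom xs = uniform (length xs) (λ i → pure (List.lookup xs i))

expectation : Rand A → (A → ℚ) → ℚ
expectation (pure a)      f = f a
expectation (uniform m r) f =
  (+ 1 / m) * sum (λ i → expectation (r i) f)

Pr : Rand A → {P : Pred A 0ℓ} → Decidable P → ℚ
Pr r P? = expectation r (λ a → if does (P? a) then 1ℚ else 0ℚ)

Colouring : ℕ → ℕ → Set
Colouring n k = Vec (Fin k) n

occurrences : Vec (Fin k) n → Fin k → ℕ
occurrences x j = count (Fin._≟ j) x

configuration : Colouring n k → Vec ℕ k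
configuration x = tabulate (occurrences x)

maximum : Vec ℕ k → ℕ
maximum = Vec.foldr′ _⊔_ 0

Monochromatic : ℕ → Vec ℕ k → Set
Monochromatic n c = ∃[ j ] lookup c j ≡ n

monochromatic? : ∀ n → Decidable (Monochromatic {k} n)
monochromatic? n c = Fin.any? (λ j → lookup c j ℕ.≟ n)

Plurality : Vec (Fin k) h → Fin k → Set
Plurality s j = ∀ i → occurrences s i ℕ.≤ occurrences s j

plurality? : (s : Vec (Fin k) h) → Decidable (Plurality s)
plurality? s j = Fin.all? (λ i → occurrences s i ℕ.≤? occurrences s j)

winners : Vec (Fin k) h → List (Fin k)
winners s = filter (plurality? s) (allFin _)

winners-nonempty : (s : Vec (Fin k) h) → .{{NonZero h}} →
                   NonZero (length (winners s))
winners-nonempty {h = suc _} s@(j ∷ _) =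
  ℕ.>-nonZero (∈-length (∈-filter⁺ (plurality? s) (∈-allFin best) best-wins))
  where
  best = argmax (occurrences s) j (allFin _)

  best-wins : Plurality s best
  best-wins i =
    ListAll.lookup (f[xs]≤f[argmax] {f = occurrences s} j (allFin _))
                   (∈-allFin i)

plurality : .{{NonZero h}} → Vec (Fin k) h → Rand (Fin k)
plurality s = uniformFrom (winners s) {{winners-nonempty s}}

-- The new colour of one node. All nodes, the node itself included, are
-- sampled with repetition, so this law is the same for every node.
recolour : ∀ h .{{_ : NonZero h}} .{{_ : NonZero n}} →
           Colouring n k → Rand (Fin k)
recolour {n = n} h x = independently h (uniform n pure) >>= λ vs →
                       plurality (Vec.map (lookup x) vs)

pluralityRound : ∀ h .{{_ : NonZero h}} .{{_ : NonZero n}} →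
                 Colouring n k → Rand (Colouring n k)
pluralityRound {n = n} h x = independently n (recolour h x)

-- The configurations C⁽⁰⁾ , … , C⁽ᵀ⁾ of the h-plurality protocol.
trajectory : ∀ h .{{_ : NonZero h}} .{{_ : NonZero n}} →
             Colouring n k → (T : ℕ) → Rand (List (Vec ℕ k))
trajectory h x zero    = pure (configuration x ∷ [])
trajectory h x (suc T) = pluralityRound h x >>= λ y →
                         trajectory h y T >>= λ ω →
                         pure (configuration x ∷ ω)

-- The first monochromatic round of a trajectory; `nothing` stands for ∞.
τ : ℕ → List (Vec ℕ k) → Maybe ℕ
τ n ω = Maybe.map toℕ (findIndex (monochromatic? n) ω)

-- b ≤ τ. On C⁽⁰⁾ , … , C⁽ᵀ⁾ this is implied by the same event for the
-- infinite trajectory, and coincides with it once b ≤ T + 1. A lower bound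
-- on the probability for every T is thus the bound for the infinite process.
τ≥ : ℕ → ℚ → List (Vec ℕ k) → Set
τ≥ n b ω = MaybeAll.All (λ t → b ≤ + t / 1) (τ n ω)

τ≥? : ∀ n b → Decidable (τ≥ {k} n b)
τ≥? n b ω = MaybeAll.dec (λ t → b ℚ.≤? (+ t / 1)) (τ n ω)

_^ℤ_ : (n : ℕ) .{{_ : NonZero n}} → ℤ → ℚ
n ^ℤ (+ p)    = + (n ℕ.^ p) / 1
n ^ℤ -[1+ p ] = (+ 1 / (n ℕ.^ suc p)) {{ℕ.m^n≢0 n (suc p)}}

-- x ≤ K · nʳ for x, K ≥ 0 and rational r = p / q: since nʳ need not be
-- rational, both sides are raised to the power q. Restricting real constants
-- K and r to ℚ loses nothing when, by monotonicity, they may be relaxed or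
-- tightened slightly.
_≤[_·_^_] : ℚ → ℚ → (n : ℕ) .{{_ : NonZero n}} → ℚ → Set
x ≤[ K · n ^ r ] = x ^ (↧ₙ r) ≤ (K ^ (↧ₙ r)) * (n ^ℤ (↥ r))

{-# OPTIONS --safe #-}

-- A node adopts colour j with probability at most p_j + C(h,2) p_j², where p_j is the
-- fraction of nodes of colour j: if j appears N_j times in the sample, it wins with
-- probability at most N_j/h + C(N_j,2). As long as all c_j ≤ 4n/k this is p_j (1 + 2h²/k).
-- The next c_j is binomial, so E b^c_j is explicit, and for b_s = 1 + 1/(s+1) the potential
-- Σ_j b_s^c_j is a supermartingale when s decreases by 2 per remaining round and stays
-- below R = k/(2h²). Over N ≈ R/g rounds the base changes little, b_(R-2N) ≤ b_R²; hence
-- reaching a colour of size D > 4n/k from max c_j ≤ 3n/(2k) has probability at most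
-- k b_R^(3n/k) / b_R^D ≤ k (1 + 1/(R+1))^(-n/k) ≤ k 2^-⌊n/k²⌋. If γk/h² ≤ 1, nothing can
-- happen before the threshold; otherwise h² < γk turns k/h ≤ K n^(1/4 − ε) into
-- k² ≤ n^(1 − δ), so this bound is superpolynomially small and α = 1 works.
module Submission where

open import Defs
open import Algebra.Bundles using (CommutativeRing)
open import Data.Bool.Base using (Bool; true; false; if_then_else_)
open import Data.Fin.Base using (Fin; zero; suc; toℕ)
import Data.Fin.Properties as Fin
open import Data.Integer.Base as ℤ using (+_; -[1+_])
import Data.Integer.Properties as ℤ
open import Data.List.Base as List using (List; []; _∷_)
open import Data.Maybe.Base using (just; nothing)
import Data.Maybe.Relation.Unary.All as MaybeAll
open import Data.Nat.Base as ℕ using (ℕ; zero; suc; NonZero)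
import Data.Nat.DivMod as ℕ
import Data.Nat.Properties as ℕ
open import Data.Nat.Properties using (m^n≢0)
open import Data.Nat.Solver renaming (module +-*-Solver to ℕ-Solver)
open import Data.Product.Base using (∃-syntax; _×_; _,_)
open import Data.Rational.Base as ℚ
  using (ℚ; mkℚ; 0ℚ; 1ℚ; _/_; _*_; _+_; _-_; -_; _<_; _≤_; *<*; ↥_; ↧ₙ_)
import Data.Rational.Properties as ℚ
open import Data.Rational.Solver using (module +-*-Solver)
import Data.Rational.Unnormalised.Base as ℚᵘ
import Data.Rational.Unnormalised.Properties as ℚᵘ
open import Data.Vec.Base as Vec using (Vec; []; _∷_; sum)
open import Data.Vec.Properties using (lookup∘tabulate)
open import Level using (0ℓ)
open import Relation.Binary.PropositionalEquality
  using (_≡_; refl; sym; trans; cong; cong₂; subst; subst₂; module ≡-Reasoning)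
open import Relation.Nullary.Decidable using (Dec; yes; no; does; dec-true; dec-false)
open import Relation.Nullary.Negation using (¬_; contradiction)
open import Relation.Unary using (Pred; Decidable)

open import Algebra.Properties.CommutativeSemiring.Exp
  (CommutativeRing.commutativeSemiring ℚ.+-*-commutativeRing)
  using (_^_; ^-homo-*; ^-assocʳ; ^-distrib-*)
open import Algebra.Properties.Semiring.Sum
  (CommutativeRing.semiring ℚ.+-*-commutativeRing)
  using (sum-cong-≗; *-distribˡ-sum; ∑-distrib-+)
  renaming (sum to ∑)
open +-*-Solver using (solve; _:+_; _:*_; _:-_; _:=_; con)
open ℕ-Solver using () renaming (_:*_ to _⊛_; _:+_ to _⊞_; _:=_ to _≐_; con to lit)

private variable
  A B : Set
  a b c d : ℚ
  h k m n : ℕ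

-- Rational arithmetic

opaque
  -- Opaque, so that the normalised fraction `+ n / 1` does not unfold in later goals; outside the
  -- block only the laws proved here are available.
  ι : ℕ → ℚ
  ι n = + n / 1

  ι-def : ∀ n → + n / 1 ≡ ι n
  ι-def n = refl

  private
    ιᵘ : ∀ n → ℚ.toℚᵘ (ι n) ℚᵘ.≃ ℚᵘ.mkℚᵘ (+ n) 0
    ιᵘ n = ℚ.toℚᵘ-fromℚᵘ (ℚᵘ.mkℚᵘ (+ n) 0)

  ι-0 : ι 0 ≡ 0ℚ
  ι-0 = refl

  ι-1 : ι 1 ≡ 1ℚ
  ι-1 = refl

  ι-+ : ∀ m n → ι (m ℕ.+ n) ≡ ι m + ι n
  ι-+ m n = ℚ.toℚᵘ-injective (begin
    ℚ.toℚᵘ (ι (m ℕ.+ n))                       ≈⟨ ιᵘ (m ℕ.+ n) ⟩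
    ℚᵘ.mkℚᵘ (+ (m ℕ.+ n)) 0                    ≈⟨ ℚᵘ.*≡* (cong (ℤ._* + 1)
      (cong₂ ℤ._+_ (sym (ℤ.*-identityʳ (+ m))) (sym (ℤ.*-identityʳ (+ n))))) ⟩
    ℚᵘ.mkℚᵘ (+ m) 0 ℚᵘ.+ ℚᵘ.mkℚᵘ (+ n) 0       ≈⟨ ℚᵘ.+-cong (ιᵘ m) (ιᵘ n) ⟨
    ℚ.toℚᵘ (ι m) ℚᵘ.+ ℚ.toℚᵘ (ι n)             ≈⟨ ℚ.toℚᵘ-homo-+ (ι m) (ι n) ⟨
    ℚ.toℚᵘ (ι m + ι n)                         ∎)
    where open ℚᵘ.≃-Reasoning

  /-*-ι : ∀ m n .{{_ : NonZero n}} → (+ m / n) * ι n ≡ ι m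
  /-*-ι m n@(suc n-1) = ℚ.toℚᵘ-injective (begin
    ℚ.toℚᵘ ((+ m / n) * ι n)                     ≈⟨ ℚ.toℚᵘ-homo-* (+ m / n) (ι n) ⟩
    ℚ.toℚᵘ (+ m / n) ℚᵘ.* ℚ.toℚᵘ (ι n)           ≈⟨ ℚᵘ.*-cong
      (ℚ.toℚᵘ-fromℚᵘ (ℚᵘ.mkℚᵘ (+ m) n-1)) (ιᵘ n) ⟩
    ℚᵘ.mkℚᵘ (+ m) n-1 ℚᵘ.* ℚᵘ.mkℚᵘ (+ n) 0       ≈⟨ ℚᵘ.*≡* (trans
      (ℤ.*-identityʳ (+ m ℤ.* + n))
      (cong (+ m ℤ.*_) (cong +_ (sym (ℕ.*-identityʳ n))))) ⟩
    ℚᵘ.mkℚᵘ (+ m) 0                              ≈⟨ ιᵘ m ⟨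
    ℚ.toℚᵘ (ι m)                                 ∎)
    where open ℚᵘ.≃-Reasoning

  ι-mono-≤ : m ℕ.≤ n → ι m ≤ ι n
  ι-mono-≤ {m} {n} m≤n = ℚ.toℚᵘ-cancel-≤ (begin
    ℚ.toℚᵘ (ι m)     ≃⟨ ιᵘ m ⟩
    ℚᵘ.mkℚᵘ (+ m) 0  ≤⟨ ℚᵘ.*≤* (ℤ.*-monoʳ-≤-nonNeg (+ 1) (ℤ.+≤+ m≤n)) ⟩
    ℚᵘ.mkℚᵘ (+ n) 0  ≃⟨ ιᵘ n ⟨
    ℚ.toℚᵘ (ι n)     ∎)
    where open ℚᵘ.≤-Reasoning

  ι-mono-< : m ℕ.< n → ι m < ι n
  ι-mono-< {m} {n} m<n = ℚ.toℚᵘ-cancel-< (begin-strict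
    ℚ.toℚᵘ (ι m)     ≃⟨ ιᵘ m ⟩
    ℚᵘ.mkℚᵘ (+ m) 0  <⟨ ℚᵘ.*<* (ℤ.*-monoʳ-<-pos (+ 1) (ℤ.+<+ m<n)) ⟩
    ℚᵘ.mkℚᵘ (+ n) 0  ≃⟨ ιᵘ n ⟨
    ℚ.toℚᵘ (ι n)     ∎)
    where open ℚᵘ.≤-Reasoning

ι-cancel-≤ : ι m ≤ ι n → m ℕ.≤ n
ι-cancel-≤ ιm≤ιn = ℕ.≮⇒≥ λ n<m → ℚ.<-irrefl refl (ℚ.<-≤-trans (ι-mono-< n<m) ιm≤ιn)

ι-cancel-< : ι m < ι n → m ℕ.< n
ι-cancel-< ιm<ιn = ℕ.≰⇒> λ n≤m → ℚ.<-irrefl refl (ℚ.<-≤-trans ιm<ιn (ι-mono-≤ n≤m))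

ι-suc : ∀ n → ι (suc n) ≡ 1ℚ + ι n
ι-suc n = trans (ι-+ 1 n) (cong (_+ ι n) ι-1)

ι-* : ∀ m n → ι (m ℕ.* n) ≡ ι m * ι n
ι-* zero    n = trans ι-0 (sym (trans (cong (_* ι n) ι-0) (ℚ.*-zeroˡ (ι n))))
ι-* (suc m) n = begin
  ι (n ℕ.+ m ℕ.* n)     ≡⟨ ι-+ n (m ℕ.* n) ⟩
  ι n + ι (m ℕ.* n)     ≡⟨ cong (ι n ℚ.+_) (ι-* m n) ⟩
  ι n + ι m * ι n       ≡⟨ solve 2 (λ x y → x :+ y :* x := (con 1ℚ :+ y) :* x) refl (ι n) (ι m) ⟩
  (1ℚ + ι m) * ι n      ≡⟨ cong (_* ι n) (ι-suc m) ⟨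
  ι (suc m) * ι n       ∎
  where open ≡-Reasoning

ι-^ : ∀ m n → ι (m ℕ.^ n) ≡ ι m ^ n
ι-^ m zero    = ι-1
ι-^ m (suc n) = trans (ι-* m (m ℕ.^ n)) (cong (ι m *_) (ι-^ m n))

0≤ι : ∀ n → 0ℚ ≤ ι n
0≤ι n = subst (_≤ ι n) ι-0 (ι-mono-≤ ℕ.z≤n)

0<ι : ∀ n .{{_ : NonZero n}} → 0ℚ < ι n
0<ι n = subst (_< ι n) ι-0 (ι-mono-< (ℕ.>-nonZero⁻¹ n))

0≤1 : 0ℚ ≤ 1ℚ
0≤1 = subst (0ℚ ≤_) ι-1 (0≤ι 1)

0<1 : 0ℚ < 1ℚ
0<1 = subst (0ℚ <_) ι-1 (0<ι 1)

*-monoʳ-≤ : 0ℚ ≤ a → b ≤ c → a * b ≤ a * c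
*-monoʳ-≤ {a} 0≤a = ℚ.*-monoˡ-≤-nonNeg a {{ℚ.nonNegative 0≤a}}

*-monoˡ-≤ : 0ℚ ≤ a → b ≤ c → b * a ≤ c * a
*-monoˡ-≤ {a} 0≤a = ℚ.*-monoʳ-≤-nonNeg a {{ℚ.nonNegative 0≤a}}

*-mono-≤ : 0ℚ ≤ a → 0ℚ ≤ d → a ≤ b → c ≤ d → a * c ≤ b * d
*-mono-≤ 0≤a 0≤d a≤b c≤d = ℚ.≤-trans (*-monoʳ-≤ 0≤a c≤d) (*-monoˡ-≤ 0≤d a≤b)

*-cancelʳ-≤ : 0ℚ < c → a * c ≤ b * c → a ≤ b
*-cancelʳ-≤ {c} 0<c = ℚ.*-cancelʳ-≤-pos c {{ℚ.positive 0<c}}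

*-cancelˡ-≤ : 0ℚ < c → c * a ≤ c * b → a ≤ b
*-cancelˡ-≤ {c} 0<c = ℚ.*-cancelˡ-≤-pos c {{ℚ.positive 0<c}}

0≤*0≤⇒0≤ : 0ℚ ≤ a → 0ℚ ≤ b → 0ℚ ≤ a * b
0≤*0≤⇒0≤ {a} {b} 0≤a 0≤b = subst (_≤ a * b) (ℚ.*-zeroʳ a) (*-monoʳ-≤ 0≤a 0≤b)

0<*0<⇒0< : 0ℚ < a → 0ℚ < b → 0ℚ < a * b
0<*0<⇒0< {a} {b} 0<a 0<b = subst (_< a * b) (ℚ.*-zeroʳ a) (ℚ.*-monoʳ-<-pos a {{ℚ.positive 0<a}} 0<b)

0≤+0≤⇒0≤ : 0ℚ ≤ a → 0ℚ ≤ b → 0ℚ ≤ a + b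
0≤+0≤⇒0≤ = ℚ.+-mono-≤

a≤a+b : 0ℚ ≤ b → a ≤ a + b
a≤a+b {b} {a} 0≤b = subst (_≤ a + b) (ℚ.+-identityʳ a) (ℚ.+-monoʳ-≤ a 0≤b)

b≤a+b : 0ℚ ≤ a → b ≤ a + b
b≤a+b {a} {b} 0≤a = subst (_≤ a + b) (ℚ.+-identityˡ b) (ℚ.+-monoˡ-≤ b 0≤a)

0≤/ : ∀ m n .{{_ : NonZero n}} → 0ℚ ≤ + m / n
0≤/ m n = *-cancelʳ-≤ (0<ι n)
  (subst₂ _≤_ (sym (ℚ.*-zeroˡ (ι n))) (sym (/-*-ι m n)) (0≤ι m))

0≤^ : ∀ n → 0ℚ ≤ a → 0ℚ ≤ a ^ n
0≤^ zero    0≤a = 0≤1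
0≤^ (suc n) 0≤a = 0≤*0≤⇒0≤ 0≤a (0≤^ n 0≤a)

0<^ : ∀ n → 0ℚ < a → 0ℚ < a ^ n
0<^ zero    0<a = 0<1
0<^ (suc n) 0<a = 0<*0<⇒0< 0<a (0<^ n 0<a)

^-monoˡ-≤ : ∀ n → 0ℚ ≤ a → a ≤ b → a ^ n ≤ b ^ n
^-monoˡ-≤ zero    0≤a a≤b = ℚ.≤-refl
^-monoˡ-≤ (suc n) 0≤a a≤b =
  *-mono-≤ 0≤a (0≤^ n (ℚ.≤-trans 0≤a a≤b)) a≤b (^-monoˡ-≤ n 0≤a a≤b)

1≤^ : ∀ n → 1ℚ ≤ a → 1ℚ ≤ a ^ n
1≤^ zero    1≤a = ℚ.≤-refl
1≤^ {a} (suc n) 1≤a = *-mono-≤ 0≤1 (ℚ.≤-trans 0≤1 (1≤^ n 1≤a)) 1≤a (1≤^ n 1≤a)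

^-monoʳ-≤ : 1ℚ ≤ a → m ℕ.≤ n → a ^ m ≤ a ^ n
^-monoʳ-≤ {n = n} 1≤a ℕ.z≤n       = 1≤^ n 1≤a
^-monoʳ-≤         1≤a (ℕ.s≤s m≤n) = *-monoʳ-≤ (ℚ.≤-trans 0≤1 1≤a) (^-monoʳ-≤ 1≤a m≤n)

bernoulli : ∀ n → 0ℚ ≤ a → 1ℚ + ι n * a ≤ (1ℚ + a) ^ n
bernoulli {a} zero    0≤a = ℚ.≤-reflexive (trans
  (cong (λ z → 1ℚ + z * a) ι-0) (trans (cong (1ℚ ℚ.+_) (ℚ.*-zeroˡ a)) (ℚ.+-identityʳ 1ℚ)))
bernoulli {a} (suc n) 0≤a = begin
  1ℚ + ι (suc n) * a                    ≡⟨ cong (λ z → 1ℚ + z * a) (ι-suc n) ⟩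
  1ℚ + (1ℚ + ι n) * a                   ≤⟨ a≤a+b (0≤*0≤⇒0≤ (0≤ι n) (0≤*0≤⇒0≤ 0≤a 0≤a)) ⟩
  1ℚ + (1ℚ + ι n) * a + ι n * (a * a)   ≡⟨ solve 2 (λ m a →
    con 1ℚ :+ (con 1ℚ :+ m) :* a :+ m :* (a :* a) := (con 1ℚ :+ a) :* (con 1ℚ :+ m :* a))
    refl (ι n) a ⟩
  (1ℚ + a) * (1ℚ + ι n * a)             ≤⟨ *-monoʳ-≤ (0≤+0≤⇒0≤ 0≤1 0≤a) (bernoulli n 0≤a) ⟩
  (1ℚ + a) * (1ℚ + a) ^ n               ∎
  where open ℚ.≤-Reasoning

-- Division-free form of (1+a)^n ≤ 1/(1-na), valid whatever the sign of 1-na. In the induction,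
-- (1+a)(1-(n+1)a) falls short of 1-na by exactly (n+1)a².
[1+a]^n*[1-na]≤1 : ∀ n → 0ℚ ≤ a → (1ℚ + a) ^ n * (1ℚ - ι n * a) ≤ 1ℚ
[1+a]^n*[1-na]≤1 {a} zero    0≤a = ℚ.≤-reflexive (trans (cong (λ z → 1ℚ * (1ℚ - z * a)) ι-0)
  (solve 1 (λ a → con 1ℚ :* (con 1ℚ :- con 0ℚ :* a) := con 1ℚ) refl a))
[1+a]^n*[1-na]≤1 {a} (suc n) 0≤a = begin
  (1ℚ + a) * (1ℚ + a) ^ n * (1ℚ - ι (suc n) * a)
    ≡⟨ cong (λ z → (1ℚ + a) * (1ℚ + a) ^ n * (1ℚ - z * a)) (ι-suc n) ⟩
  (1ℚ + a) * (1ℚ + a) ^ n * (1ℚ - (1ℚ + ι n) * a)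
    ≤⟨ a≤a+b (0≤*0≤⇒0≤ (0≤^ n (0≤+0≤⇒0≤ 0≤1 0≤a))
         (0≤*0≤⇒0≤ (0≤+0≤⇒0≤ 0≤1 (0≤ι n)) (0≤*0≤⇒0≤ 0≤a 0≤a))) ⟩
  (1ℚ + a) * (1ℚ + a) ^ n * (1ℚ - (1ℚ + ι n) * a) + (1ℚ + a) ^ n * ((1ℚ + ι n) * (a * a))
    ≡⟨ solve 3 (λ p m a → (con 1ℚ :+ a) :* p :* (con 1ℚ :- (con 1ℚ :+ m) :* a)
                            :+ p :* ((con 1ℚ :+ m) :* (a :* a))
                          := p :* (con 1ℚ :- m :* a))
         refl ((1ℚ + a) ^ n) (ι n) a ⟩
  (1ℚ + a) ^ n * (1ℚ - ι n * a)
    ≤⟨ [1+a]^n*[1-na]≤1 n 0≤a ⟩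
  1ℚ ∎
  where open ℚ.≤-Reasoning

-- Expectations

sum-mono-≤ : {f g : Fin n → ℚ} → (∀ i → f i ≤ g i) → ∑ f ≤ ∑ g
sum-mono-≤ {zero}  f≤g = ℚ.≤-refl
sum-mono-≤ {suc n} f≤g = ℚ.+-mono-≤ (f≤g zero) (sum-mono-≤ (λ i → f≤g (suc i)))

sum-const : ∀ n a → ∑ {n} (λ _ → a) ≡ ι n * a
sum-const zero    a = sym (trans (cong (_* a) ι-0) (ℚ.*-zeroˡ a))
sum-const (suc n) a = begin
  a + ∑ {n} (λ _ → a)  ≡⟨ cong (a ℚ.+_) (sum-const n a) ⟩
  a + ι n * a            ≡⟨ solve 2 (λ a m → a :+ m :* a := (con 1ℚ :+ m) :* a) refl a (ι n) ⟩
  (1ℚ + ι n) * a         ≡⟨ cong (_* a) (ι-suc n) ⟨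
  ι (suc n) * a          ∎
  where open ≡-Reasoning

0≤sum : {f : Fin n → ℚ} → (∀ i → 0ℚ ≤ f i) → 0ℚ ≤ ∑ f
0≤sum {zero}  0≤f = ℚ.≤-refl
0≤sum {suc n} 0≤f = 0≤+0≤⇒0≤ (0≤f zero) (0≤sum (λ i → 0≤f (suc i)))

term≤sum : {f : Fin n → ℚ} → (∀ i → 0ℚ ≤ f i) → ∀ j → f j ≤ ∑ f
term≤sum 0≤f zero    = a≤a+b (0≤sum (λ i → 0≤f (suc i)))
term≤sum 0≤f (suc j) = ℚ.≤-trans (term≤sum (λ i → 0≤f (suc i)) j) (b≤a+b (0≤f zero))

𝟙 : Bool → ℚ
𝟙 b = if b then 1ℚ else 0ℚ

0≤𝟙 : ∀ b → 0ℚ ≤ 𝟙 b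
0≤𝟙 true  = 0≤1
0≤𝟙 false = ℚ.≤-refl

𝟙≤1 : ∀ b → 𝟙 b ≤ 1ℚ
𝟙≤1 true  = ℚ.≤-refl
𝟙≤1 false = 0≤1

sum-*-𝟙≟ : (f : Fin n → ℚ) (j : Fin n) → ∑ (λ i → f i * 𝟙 (does (i Fin.≟ j))) ≡ f j
sum-*-𝟙≟ {suc n} f zero = begin
  f zero * 1ℚ + ∑ (λ i → f (suc i) * 0ℚ)  ≡⟨ cong (f zero * 1ℚ ℚ.+_)
    (trans (sum-cong-≗ (λ i → ℚ.*-zeroʳ (f (suc i)))) (trans (sum-const n 0ℚ) (ℚ.*-zeroʳ (ι n)))) ⟩
  f zero * 1ℚ + 0ℚ                          ≡⟨ ℚ.+-identityʳ _ ⟩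
  f zero * 1ℚ                               ≡⟨ ℚ.*-identityʳ _ ⟩
  f zero                                    ∎
  where open ≡-Reasoning
sum-*-𝟙≟ f (suc j) = trans (cong₂ _+_ (ℚ.*-zeroʳ (f zero)) (sum-*-𝟙≟ (λ i → f (suc i)) j))
  (ℚ.+-identityˡ (f (suc j)))

ι-occurrences-∷ : ∀ (i : Fin k) (s : Vec (Fin k) n) j →
                  ι (occurrences (i ∷ s) j) ≡ 𝟙 (does (i Fin.≟ j)) + ι (occurrences s j)
ι-occurrences-∷ i s j with does (i Fin.≟ j)
... | true  = ι-suc _
... | false = sym (ℚ.+-identityˡ _)

expectation-cong : (r : Rand A) {f g : A → ℚ} → (∀ a → f a ≡ g a) →
                   expectation r f ≡ expectation r g
expectation-cong (pure a)      f≗g = f≗g a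
expectation-cong (uniform m r) f≗g =
  cong ((+ 1 / m) *_) (sum-cong-≗ (λ i → expectation-cong (r i) f≗g))

expectation-mono-≤ : (r : Rand A) {f g : A → ℚ} → (∀ a → f a ≤ g a) →
                     expectation r f ≤ expectation r g
expectation-mono-≤ (pure a)      f≤g = f≤g a
expectation-mono-≤ (uniform m r) f≤g =
  *-monoʳ-≤ (0≤/ 1 m) (sum-mono-≤ (λ i → expectation-mono-≤ (r i) f≤g))

expectation-const : (r : Rand A) (c : ℚ) → expectation r (λ _ → c) ≡ c
expectation-const (pure a)      c = refl
expectation-const (uniform m r) c = begin
  (+ 1 / m) * ∑ (λ i → expectation (r i) (λ _ → c))
    ≡⟨ cong ((+ 1 / m) *_) (trans (sum-cong-≗ (λ i → expectation-const (r i) c)) (sum-const m c)) ⟩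
  (+ 1 / m) * (ι m * c)  ≡⟨ ℚ.*-assoc (+ 1 / m) (ι m) c ⟨
  (+ 1 / m) * ι m * c    ≡⟨ cong (_* c) (trans (/-*-ι 1 m) ι-1) ⟩
  1ℚ * c                 ≡⟨ ℚ.*-identityˡ c ⟩
  c                      ∎
  where open ≡-Reasoning

expectation-+ : (r : Rand A) (f g : A → ℚ) →
                expectation r (λ a → f a + g a) ≡ expectation r f + expectation r g
expectation-+ (pure a)      f g = refl
expectation-+ (uniform m r) f g = begin
  (+ 1 / m) * ∑ (λ i → expectation (r i) (λ a → f a + g a))
    ≡⟨ cong ((+ 1 / m) *_) (trans (sum-cong-≗ (λ i → expectation-+ (r i) f g))
         (∑-distrib-+ (λ i → expectation (r i) f) (λ i → expectation (r i) g))) ⟩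
  (+ 1 / m) * (∑ (λ i → expectation (r i) f) + ∑ (λ i → expectation (r i) g))
    ≡⟨ ℚ.*-distribˡ-+ (+ 1 / m) _ _ ⟩
  (+ 1 / m) * ∑ (λ i → expectation (r i) f) + (+ 1 / m) * ∑ (λ i → expectation (r i) g) ∎
  where open ≡-Reasoning

expectation-*ˡ : (r : Rand A) (c : ℚ) (f : A → ℚ) →
                 expectation r (λ a → c * f a) ≡ c * expectation r f
expectation-*ˡ (pure a)      c f = refl
expectation-*ˡ (uniform m r) c f = begin
  (+ 1 / m) * ∑ (λ i → expectation (r i) (λ a → c * f a))
    ≡⟨ cong ((+ 1 / m) *_) (trans (sum-cong-≗ (λ i → expectation-*ˡ (r i) c f))
         (sym (*-distribˡ-sum c (λ i → expectation (r i) f)))) ⟩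
  (+ 1 / m) * (c * ∑ (λ i → expectation (r i) f))
    ≡⟨ solve 3 (λ u c s → u :* (c :* s) := c :* (u :* s)) refl (+ 1 / m) c _ ⟩
  c * ((+ 1 / m) * ∑ (λ i → expectation (r i) f)) ∎
  where open ≡-Reasoning

expectation-*ʳ : (r : Rand A) (f : A → ℚ) (c : ℚ) →
                 expectation r (λ a → f a * c) ≡ expectation r f * c
expectation-*ʳ r f c = trans (expectation-cong r (λ a → ℚ.*-comm (f a) c))
  (trans (expectation-*ˡ r c f) (ℚ.*-comm c _))

expectation-sum : (r : Rand A) (f : Fin n → A → ℚ) →
                  expectation r (λ a → ∑ (λ i → f i a)) ≡ ∑ (λ i → expectation r (f i))
expectation-sum {n = zero}  r f = expectation-const r 0ℚ
expectation-sum {n = suc n} r f =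
  trans (expectation-+ r (f zero) (λ a → ∑ (λ i → f (suc i) a)))
        (cong (expectation r (f zero) ℚ.+_) (expectation-sum r (λ i → f (suc i))))

expectation->>= : (r : Rand A) (g : A → Rand B) (f : B → ℚ) →
                  expectation (r >>= g) f ≡ expectation r (λ a → expectation (g a) f)
expectation->>= (pure a)      g f = refl
expectation->>= (uniform m r) g f =
  cong ((+ 1 / m) *_) (sum-cong-≗ (λ i → expectation->>= (r i) g f))

expectation-independently-suc :
  ∀ n (r : Rand A) (f : Vec A (suc n) → ℚ) →
  expectation (independently (suc n) r) f ≡
  expectation r (λ a → expectation (independently n r) (λ as → f (a ∷ as)))
expectation-independently-suc n r f =
  trans (expectation->>= r (λ a → independently n r >>= λ as → pure (a ∷ as)) f)
        (expectation-cong r (λ a → expectation->>= (independently n r) (λ as → pure (a ∷ as)) f))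

-- The generating function of a binomial variable: the `n` draws are independent, and each
-- contributes a factor 1 + a or 1 according to whether it hits `j`.
expectation-^-occurrences :
  ∀ n (r : Rand (Fin k)) (j : Fin k) (a : ℚ) →
  expectation (independently n r) (λ y → (1ℚ + a) ^ occurrences y j) ≡
  (1ℚ + a * expectation r (λ i → 𝟙 (does (i Fin.≟ j)))) ^ n
expectation-^-occurrences zero    r j a = refl
expectation-^-occurrences (suc n) r j a = begin
  expectation (independently (suc n) r) (λ y → (1ℚ + a) ^ occurrences y j)
    ≡⟨ expectation-independently-suc n r (λ y → (1ℚ + a) ^ occurrences y j) ⟩
  expectation r (λ i → expectation (independently n r) (λ y → (1ℚ + a) ^ occurrences (i ∷ y) j))
    ≡⟨ expectation-cong r (λ i → trans
         (expectation-cong (independently n r) (λ y → split i y))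
         (trans (expectation-*ˡ (independently n r) (weight i) (λ y → (1ℚ + a) ^ occurrences y j))
                (cong (weight i *_) (expectation-^-occurrences n r j a)))) ⟩
  expectation r (λ i → weight i * W ^ n)
    ≡⟨ expectation-*ʳ r weight (W ^ n) ⟩
  expectation r weight * W ^ n
    ≡⟨ cong (_* W ^ n) (trans (expectation-+ r (λ _ → 1ℚ) (λ i → a * 𝟙 (does (i Fin.≟ j))))
         (cong₂ _+_ (expectation-const r 1ℚ) (expectation-*ˡ r a (λ i → 𝟙 (does (i Fin.≟ j)))))) ⟩
  W * W ^ n ∎
  where
  open ≡-Reasoning
  W = 1ℚ + a * expectation r (λ i → 𝟙 (does (i Fin.≟ j)))
  weight : Fin _ → ℚ
  weight i = 1ℚ + a * 𝟙 (does (i Fin.≟ j))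
  split : ∀ i (y : Vec (Fin _) n) →
          (1ℚ + a) ^ occurrences (i ∷ y) j ≡ weight i * (1ℚ + a) ^ occurrences y j
  split i y with does (i Fin.≟ j)
  ... | true  = cong (_* (1ℚ + a) ^ occurrences y j) (cong (1ℚ ℚ.+_) (sym (ℚ.*-identityʳ a)))
  ... | false = solve 2 (λ p a → p := (con 1ℚ :+ a :* con 0ℚ) :* p) refl ((1ℚ + a) ^ occurrences y j) a

-- `uniformFrom` draws a position in a filtered list. This turns sums over positions into
-- indicator-weighted sums over the whole index set.
sum-lookup-filter :
  {P : Pred A 0ℓ} (P? : Decidable P) (f : Fin n → A) (g : A → ℚ) →
  ∑ (λ i → g (List.lookup (List.filter P? (List.tabulate f)) i)) ≡
  ∑ (λ i → 𝟙 (does (P? (f i))) * g (f i))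
sum-lookup-filter {n = zero}  P? f g = refl
sum-lookup-filter {n = suc n} P? f g with does (P? (f zero))
... | true  = cong₂ _+_ (sym (ℚ.*-identityˡ (g (f zero)))) (sum-lookup-filter P? (λ i → f (suc i)) g)
... | false = trans (sum-lookup-filter P? (λ i → f (suc i)) g)
  (solve 2 (λ x s → s := con 0ℚ :* x :+ s) refl (g (f zero))
    (∑ (λ i → 𝟙 (does (P? (f (suc i)))) * g (f (suc i)))))

length-winners : (s : Vec (Fin k) h) →
                 ι (List.length (winners s)) ≡ ∑ (λ i → 𝟙 (does (plurality? s i)))
length-winners s = begin
  ι len                       ≡⟨ ℚ.*-identityʳ (ι len) ⟨
  ι len * 1ℚ                  ≡⟨ sum-const len 1ℚ ⟨
  ∑ {len} (λ _ → 1ℚ)        ≡⟨ sum-lookup-filter (plurality? s) (λ i → i) (λ _ → 1ℚ) ⟩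
  ∑ (λ i → 𝟙 (does (plurality? s i)) * 1ℚ)  ≡⟨ sum-cong-≗ (λ i → ℚ.*-identityʳ (𝟙 (does (plurality? s i)))) ⟩
  ∑ (λ i → 𝟙 (does (plurality? s i)))       ∎
  where
  open ≡-Reasoning
  len = List.length (winners s)

sum-occurrences : (s : Vec (Fin k) h) → ∑ (λ i → ι (occurrences s i)) ≡ ι h
sum-occurrences {k = k} [] = trans (sum-const k (ι 0)) (trans (cong (ι k *_) ι-0) (trans (ℚ.*-zeroʳ (ι k)) (sym ι-0)))
sum-occurrences {h = suc h} (i ∷ s) = begin
  ∑ (λ j → ι (occurrences (i ∷ s) j))
    ≡⟨ sum-cong-≗ (ι-occurrences-∷ i s) ⟩
  ∑ (λ j → 𝟙 (does (i Fin.≟ j)) + ι (occurrences s j))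
    ≡⟨ ∑-distrib-+ (λ j → 𝟙 (does (i Fin.≟ j))) (λ j → ι (occurrences s j)) ⟩
  ∑ (λ j → 𝟙 (does (i Fin.≟ j))) + ∑ (λ j → ι (occurrences s j))
    ≡⟨ cong₂ _+_ (trans (sum-cong-≗ (λ j → trans (flip j) (sym (ℚ.*-identityˡ (𝟙 (does (j Fin.≟ i))))))) (sum-*-𝟙≟ (λ _ → 1ℚ) i)) (sum-occurrences s) ⟩
  1ℚ + ι h
    ≡⟨ ι-suc h ⟨
  ι (suc h) ∎
  where
  open ≡-Reasoning
  flip : ∀ j → 𝟙 (does (i Fin.≟ j)) ≡ 𝟙 (does (j Fin.≟ i))
  flip j with i Fin.≟ j | j Fin.≟ i
  ... | yes _   | yes _   = refl
  ... | no  _   | no  _   = refl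
  ... | yes i≡j | no  j≢i = contradiction (sym i≡j) j≢i
  ... | no  i≢j | yes j≡i = contradiction (sym j≡i) i≢j

winProbability : .{{NonZero h}} → Vec (Fin k) h → Fin k → ℚ
winProbability s j = expectation (plurality s) (λ i → 𝟙 (does (i Fin.≟ j)))

-- A winner is chosen with probability 1 / (number of winners) and a loser with probability 0;
-- multiplying by the number of winners states both at once without a division.
winProbability*length : .{{_ : NonZero h}} (s : Vec (Fin k) h) (j : Fin k) →
  winProbability s j * ι (List.length (winners s)) ≡ 𝟙 (does (plurality? s j))
winProbability*length s j = begin
  (+ 1 / len) * S * ι len  ≡⟨ solve 3 (λ u s l → u :* s :* l := u :* l :* s) refl (+ 1 / len) S (ι len) ⟩
  (+ 1 / len) * ι len * S  ≡⟨ cong₂ _*_ (trans (/-*-ι 1 len) ι-1)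
    (trans (sum-lookup-filter (plurality? s) (λ i → i) (λ i → 𝟙 (does (i Fin.≟ j))))
           (sum-*-𝟙≟ (λ i → 𝟙 (does (plurality? s i))) j)) ⟩
  1ℚ * 𝟙 (does (plurality? s j))  ≡⟨ ℚ.*-identityˡ _ ⟩
  𝟙 (does (plurality? s j))  ∎
  where
  open ≡-Reasoning
  len = List.length (winners s)
  instance
    len≢0 : NonZero len
    len≢0 = winners-nonempty s
  S = ∑ (λ i → 𝟙 (does (List.lookup (winners s) i Fin.≟ j)))

-- The law of one round

-- The binomial coefficient C(n,2), via C(n+1,2) = n + C(n,2).
triangular : ℕ → ℕ
triangular zero    = 0
triangular (suc n) = n ℕ.+ triangular n

1≤occurrences-head : ∀ (i : Fin k) (s : Vec (Fin k) n) → 1 ℕ.≤ occurrences (i ∷ s) i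
1≤occurrences-head i s with i Fin.≟ i
... | yes _   = ℕ.s≤s ℕ.z≤n
... | no  i≢i = contradiction refl i≢i

plurality⇒occurs : .{{NonZero h}} → (s : Vec (Fin k) h) {j : Fin k} →
                   Plurality s j → 1 ℕ.≤ occurrences s j
plurality⇒occurs {h = suc h} (i ∷ s) j-wins = ℕ.≤-trans (1≤occurrences-head i s) (j-wins i)

-- If the winner appears only once in the sample then all sampled colours are
-- distinct, and each of them wins.
h≤length-winners : (s : Vec (Fin k) h) {j : Fin k} → Plurality s j →
                   occurrences s j ℕ.≤ 1 → ι h ≤ ι (List.length (winners s))
h≤length-winners {h = h} s j-wins once = begin
  ι h                                    ≡⟨ sum-occurrences s ⟨
  ∑ (λ i → ι (occurrences s i))        ≤⟨ sum-mono-≤ occurs⇒wins ⟩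
  ∑ (λ i → 𝟙 (does (plurality? s i)))  ≡⟨ length-winners s ⟨
  ι (List.length (winners s))            ∎
  where
  open ℚ.≤-Reasoning
  occurs⇒wins : ∀ i → ι (occurrences s i) ≤ 𝟙 (does (plurality? s i))
  occurs⇒wins i with plurality? s i
  ... | yes i-wins = subst (ι (occurrences s i) ≤_) (trans ι-1 (sym (cong 𝟙 (dec-true (plurality? s i) i-wins)))) (ι-mono-≤ (ℕ.≤-trans (j-wins i) once))
  ... | no  ¬i-wins with occurrences s i ℕ.≤? 0
  ...   | yes none = subst (ι (occurrences s i) ≤_) (trans ι-0 (sym (cong 𝟙 (dec-false (plurality? s i) ¬i-wins)))) (ι-mono-≤ none)
  ...   | no ¬none = contradiction
    (λ l → ℕ.≤-trans (ℕ.≤-trans (j-wins l) once) (ℕ.≰⇒> ¬none)) ¬i-wins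

-- Let N be the number of occurrences of `j`. A winner has N ≥ 1. For N = 1 at least `h` colours
-- tie, so the probability is at most 1/h; for N ≥ 2 the term C(N,2) ≥ 1 already exceeds any
-- probability.
winProbability-bound : .{{_ : NonZero h}} (s : Vec (Fin k) h) (j : Fin k) →
  ι h * winProbability s j ≤ ι (occurrences s j) + ι h * ι (triangular (occurrences s j))
winProbability-bound {h = h} s j = byCase (plurality? s j)
  where
  open ℚ.≤-Reasoning
  W = winProbability s j
  0≤W : 0ℚ ≤ W
  0≤W = subst (_≤ W) (expectation-const (plurality s) 0ℚ)
    (expectation-mono-≤ (plurality s) (λ i → 0≤𝟙 (does (i Fin.≟ j))))
  W≤1 : W ≤ 1ℚ
  W≤1 = subst (W ≤_) (expectation-const (plurality s) 1ℚ)
    (expectation-mono-≤ (plurality s) (λ i → 𝟙≤1 (does (i Fin.≟ j))))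
  byOccurrences : Plurality s j → ∀ N → occurrences s j ≡ N → ι h * W ≤ ι N + ι h * ι (triangular N)
  byOccurrences j-wins 0 eq = contradiction (subst (1 ℕ.≤_) eq (plurality⇒occurs s j-wins)) λ ()
  byOccurrences j-wins 1 eq = begin
    ι h * W                          ≤⟨ *-monoˡ-≤ 0≤W (h≤length-winners s j-wins (ℕ.≤-reflexive eq)) ⟩
    ι (List.length (winners s)) * W  ≡⟨ ℚ.*-comm (ι (List.length (winners s))) W ⟩
    W * ι (List.length (winners s))  ≡⟨ trans (winProbability*length s j) (cong 𝟙 (dec-true (plurality? s j) j-wins)) ⟩
    1ℚ                               ≡⟨ ι-1 ⟨
    ι 1                              ≤⟨ a≤a+b (0≤*0≤⇒0≤ (0≤ι h) (0≤ι 0)) ⟩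
    ι 1 + ι h * ι 0                  ∎
  byOccurrences _ N@(suc (suc N-2)) eq = begin
    ι h * W                       ≤⟨ *-monoʳ-≤ (0≤ι h) (ℚ.≤-trans W≤1
      (subst (_≤ ι (triangular N)) ι-1 (ι-mono-≤ (ℕ.s≤s ℕ.z≤n)))) ⟩
    ι h * ι (triangular N)        ≤⟨ b≤a+b (0≤ι N) ⟩
    ι N + ι h * ι (triangular N)  ∎
  byCase : Dec (Plurality s j) →
           ι h * W ≤ ι (occurrences s j) + ι h * ι (triangular (occurrences s j))
  byCase (yes j-wins) = byOccurrences j-wins (occurrences s j) refl
  byCase (no ¬j-wins) = begin
    ι h * W                   ≤⟨ *-monoʳ-≤ (0≤ι h) (*-cancelʳ-≤ (0<ι _ {{winners-nonempty s}})
      (ℚ.≤-reflexive (trans (winProbability*length s j) (trans (cong 𝟙 (dec-false (plurality? s j) ¬j-wins)) (sym (ℚ.*-zeroˡ (ι (List.length (winners s))))))))) ⟩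
    ι h * 0ℚ                  ≡⟨ ℚ.*-zeroʳ (ι h) ⟩
    0ℚ                        ≤⟨ 0≤+0≤⇒0≤ (0≤ι (occurrences s j))
      (0≤*0≤⇒0≤ (0≤ι h) (0≤ι (triangular (occurrences s j)))) ⟩
    ι (occurrences s j) + ι h * ι (triangular (occurrences s j)) ∎

-- Moments of the number of hits in a sample

module _ {A : Set} (r : Rand A) (colour : A → Fin k) (j : Fin k) where

  private
    hit : A → ℚ
    hit a = 𝟙 (does (colour a Fin.≟ j))

    p : ℚ
    p = expectation r hit

    N : Vec A n → ℕ
    N as = occurrences (Vec.map colour as) j

  expectation-occurrences : ∀ h →
    expectation (independently h r) (λ as → ι (N as)) ≡ ι h * p
  expectation-occurrences zero    = trans ι-0 (sym (trans (cong (_* p) ι-0) (ℚ.*-zeroˡ p)))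
  expectation-occurrences (suc h) = begin
    expectation (independently (suc h) r) (λ as → ι (N as))
      ≡⟨ expectation-independently-suc h r (λ as → ι (N as)) ⟩
    expectation r (λ a → expectation (independently h r) (λ as → ι (N (a ∷ as))))
      ≡⟨ expectation-cong r (λ a → trans
           (expectation-cong (independently h r) (λ as → ι-occurrences-∷ (colour a) (Vec.map colour as) j))
           (trans (expectation-+ (independently h r) (λ _ → hit a) (λ as → ι (N as)))
             (cong₂ _+_ (expectation-const (independently h r) (hit a)) (expectation-occurrences h)))) ⟩
    expectation r (λ a → hit a + ι h * p)
      ≡⟨ trans (expectation-+ r hit (λ _ → ι h * p)) (cong (p ℚ.+_) (expectation-const r (ι h * p))) ⟩
    p + ι h * p
      ≡⟨ solve 2 (λ p m → p :+ m :* p := (con 1ℚ :+ m) :* p) refl p (ι h) ⟩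
    (1ℚ + ι h) * p
      ≡⟨ cong (_* p) (ι-suc h) ⟨
    ι (suc h) * p ∎
    where open ≡-Reasoning

  -- C(N,2) counts the pairs of draws that both hit `j`. A new draw adds `hit a * N` pairs, and it
  -- is independent of the earlier draws, so the expectation of this product factors.
  expectation-triangular-occurrences : ∀ h →
    expectation (independently h r) (λ as → ι (triangular (N as))) ≡ ι (triangular h) * (p * p)
  expectation-triangular-occurrences zero = trans ι-0 (sym (trans (cong (_* (p * p)) ι-0) (ℚ.*-zeroˡ (p * p))))
  expectation-triangular-occurrences (suc h) = begin
    expectation (independently (suc h) r) (λ as → ι (triangular (N as)))
      ≡⟨ expectation-independently-suc h r (λ as → ι (triangular (N as))) ⟩
    expectation r (λ a → expectation (independently h r) (λ as → ι (triangular (N (a ∷ as)))))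
      ≡⟨ expectation-cong r (λ a → trans
           (expectation-cong (independently h r) (split a))
           (trans (expectation-+ (independently h r) (λ as → hit a * ι (N as)) (λ as → ι (triangular (N as))))
             (cong₂ _+_ (trans (expectation-*ˡ (independently h r) (hit a) (λ as → ι (N as)))
                               (cong (hit a *_) (expectation-occurrences h)))
                        (expectation-triangular-occurrences h)))) ⟩
    expectation r (λ a → hit a * (ι h * p) + ι (triangular h) * (p * p))
      ≡⟨ trans (expectation-+ r (λ a → hit a * (ι h * p)) (λ _ → ι (triangular h) * (p * p)))
           (cong₂ _+_ (expectation-*ʳ r hit (ι h * p)) (expectation-const r (ι (triangular h) * (p * p)))) ⟩
    p * (ι h * p) + ι (triangular h) * (p * p)
      ≡⟨ solve 3 (λ p m t → p :* (m :* p) :+ t :* (p :* p) := (m :+ t) :* (p :* p)) refl p (ι h) (ι (triangular h)) ⟩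
    (ι h + ι (triangular h)) * (p * p)
      ≡⟨ cong (_* (p * p)) (ι-+ h (triangular h)) ⟨
    ι (triangular (suc h)) * (p * p) ∎
    where
    open ≡-Reasoning
    split : ∀ a (as : Vec A h) → ι (triangular (N (a ∷ as))) ≡ hit a * ι (N as) + ι (triangular (N as))
    split a as with does (colour a Fin.≟ j)
    ... | true  = trans (ι-+ (N as) (triangular (N as)))
                        (cong (ℚ._+ ι (triangular (N as))) (sym (ℚ.*-identityˡ (ι (N as)))))
    ... | false = solve 2 (λ m t → t := con 0ℚ :* m :+ t) refl (ι (N as)) (ι (triangular (N as)))

-- Stated as the hit probability of one uniform node, which is the form in which the moment lemmas
-- produce it; `proportion-def` recovers c_j / n.
proportion : .{{NonZero n}} → Colouring n k → Fin k → ℚ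
proportion {n = n} x j = expectation (uniform n pure) (λ v → 𝟙 (does (Vec.lookup x v Fin.≟ j)))

sum-hits : (x : Colouring n k) (j : Fin k) →
           ∑ (λ v → 𝟙 (does (Vec.lookup x v Fin.≟ j))) ≡ ι (occurrences x j)
sum-hits []      j = sym ι-0
sum-hits (i ∷ x) j =
  trans (cong (𝟙 (does (i Fin.≟ j)) ℚ.+_) (sum-hits x j)) (sym (ι-occurrences-∷ i x j))

proportion-def : .{{_ : NonZero n}} (x : Colouring n k) (j : Fin k) →
                 proportion x j ≡ (+ 1 / n) * ι (occurrences x j)
proportion-def {n = n} x j = cong ((+ 1 / n) *_) (sum-hits x j)

recolourProbability : ∀ h .{{_ : NonZero h}} .{{_ : NonZero n}} → Colouring n k → Fin k → ℚ
recolourProbability h x j = expectation (recolour h x) (λ i → 𝟙 (does (i Fin.≟ j)))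

0≤expectation : (r : Rand A) {f : A → ℚ} → (∀ a → 0ℚ ≤ f a) → 0ℚ ≤ expectation r f
0≤expectation r {f} 0≤f = subst (_≤ expectation r f) (expectation-const r 0ℚ) (expectation-mono-≤ r 0≤f)

-- The average of `winProbability-bound` over the sample: E N = hp and E C(N,2) = C(h,2) p², after
-- which the factor `h` cancels.
recolourProbability-bound :
  ∀ h .{{_ : NonZero h}} .{{_ : NonZero n}} (x : Colouring n k) (j : Fin k) →
  recolourProbability h x j ≤ proportion x j + ι (triangular h) * (proportion x j * proportion x j)
recolourProbability-bound {n = n} h x j = *-cancelˡ-≤ (0<ι h) (begin
  ι h * recolourProbability h x j
    ≡⟨ cong (ι h *_) (expectation->>= samples (λ vs → plurality (Vec.map (Vec.lookup x) vs)) (λ i → 𝟙 (does (i Fin.≟ j)))) ⟩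
  ι h * expectation samples (λ vs → winProbability (Vec.map (Vec.lookup x) vs) j)
    ≡⟨ expectation-*ˡ samples (ι h) (λ vs → winProbability (Vec.map (Vec.lookup x) vs) j) ⟨
  expectation samples (λ vs → ι h * winProbability (Vec.map (Vec.lookup x) vs) j)
    ≤⟨ expectation-mono-≤ samples (λ vs → winProbability-bound (Vec.map (Vec.lookup x) vs) j) ⟩
  expectation samples (λ vs → ι (N vs) + ι h * ι (triangular (N vs)))
    ≡⟨ trans (expectation-+ samples (λ vs → ι (N vs)) (λ vs → ι h * ι (triangular (N vs))))
         (cong₂ _+_ (expectation-occurrences (uniform n pure) (Vec.lookup x) j h)
           (trans (expectation-*ˡ samples (ι h) (λ vs → ι (triangular (N vs))))
             (cong (ι h *_) (expectation-triangular-occurrences (uniform n pure) (Vec.lookup x) j h)))) ⟩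
  ι h * p + ι h * (ι (triangular h) * (p * p))
    ≡⟨ ℚ.*-distribˡ-+ (ι h) p (ι (triangular h) * (p * p)) ⟨
  ι h * (p + ι (triangular h) * (p * p)) ∎)
  where
  open ℚ.≤-Reasoning
  samples = independently h (uniform n pure)
  p = proportion x j
  N : Vec (Fin n) h → ℕ
  N vs = occurrences (Vec.map (Vec.lookup x) vs) j

-- The base of the potential. It decreases towards 1 as `m` grows, and its inverse has the
-- convenient form 1 - 1/(m+2).
β : ℕ → ℚ
β m = 1ℚ + (+ 1 / suc m)

1≤β : ∀ m → 1ℚ ≤ β m
1≤β m = a≤a+b (0≤/ 1 (suc m))

/-*-suc : ∀ m → (+ 1 / suc m) * ι (suc m) ≡ 1ℚ
/-*-suc m = trans (/-*-ι 1 (suc m)) ι-1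

-- The index drops by 2 because two losses are paid. With p = c_j/n, the hypothesis gives q ≤ p(1 +
-- 1/(m+2)) for the recolouring probability q, whence q/(m+3) ≤ p/(m+2): one unit. The other pays
-- for (1+y)^n ≤ 1/(1 - 1/(m+2)) = `β m`, where y = 1/((m+2)n).
round-bound : ∀ h .{{_ : NonZero h}} .{{_ : NonZero n}} (x : Colouring n k) (j : Fin k) m →
  triangular h ℕ.* occurrences x j ℕ.* (2 ℕ.+ m) ℕ.≤ n →
  expectation (pluralityRound h x) (λ y → β (2 ℕ.+ m) ^ occurrences y j) ≤ β m ^ occurrences x j
round-bound {n = n} h x j m small = begin
  expectation (pluralityRound h x) (λ y → β (2 ℕ.+ m) ^ occurrences y j)
    ≡⟨ expectation-^-occurrences n (recolour h x) j z ⟩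
  (1ℚ + z * q) ^ n
    ≤⟨ ^-monoˡ-≤ n (0≤+0≤⇒0≤ 0≤1 (0≤*0≤⇒0≤ 0≤z 0≤q)) (ℚ.+-monoʳ-≤ 1ℚ zq≤cy) ⟩
  (1ℚ + ι C * y) ^ n
    -- Bernoulli moves the count `C` into the exponent, so that only (1+y)^n, which no longer
    -- depends on `C`, remains to be bounded.
    ≤⟨ ^-monoˡ-≤ n (0≤+0≤⇒0≤ 0≤1 (0≤*0≤⇒0≤ (0≤ι C) 0≤y)) (bernoulli C 0≤y) ⟩
  ((1ℚ + y) ^ C) ^ n
    ≡⟨ trans (^-assocʳ (1ℚ + y) C n) (trans (cong ((1ℚ + y) ^_) (ℕ.*-comm C n)) (sym (^-assocʳ (1ℚ + y) n C))) ⟩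
  ((1ℚ + y) ^ n) ^ C
    ≤⟨ ^-monoˡ-≤ C (0≤^ n (0≤+0≤⇒0≤ 0≤1 0≤y)) [1+y]^n≤βm ⟩
  β m ^ C ∎
  where
  open ℚ.≤-Reasoning
  C = occurrences x j
  t = triangular h
  p = proportion x j
  q = recolourProbability h x j
  z = + 1 / (3 ℕ.+ m)
  u = + 1 / (2 ℕ.+ m)
  v = + 1 / suc m
  1/n = + 1 / n
  y = u * 1/n
  0≤z : 0ℚ ≤ z
  0≤z = 0≤/ 1 (3 ℕ.+ m)
  0≤u : 0ℚ ≤ u
  0≤u = 0≤/ 1 (2 ℕ.+ m)
  0≤y : 0ℚ ≤ y
  0≤y = 0≤*0≤⇒0≤ 0≤u (0≤/ 1 n)
  0≤q : 0ℚ ≤ q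
  0≤q = 0≤expectation (recolour h x) (λ i → 0≤𝟙 (does (i Fin.≟ j)))
  0≤p : 0ℚ ≤ p
  0≤p = 0≤expectation (uniform n pure) (λ i → 0≤𝟙 (does (Vec.lookup x i Fin.≟ j)))

  tp[m+2]≤1 : ι t * p * ι (2 ℕ.+ m) ≤ 1ℚ
  tp[m+2]≤1 = begin
    ι t * p * ι (2 ℕ.+ m)                ≡⟨ cong (λ w → ι t * w * ι (2 ℕ.+ m)) (proportion-def x j) ⟩
    ι t * (1/n * ι C) * ι (2 ℕ.+ m)      ≡⟨ solve 4 (λ t u C w → t :* (u :* C) :* w := u :* (t :* C :* w))
      refl (ι t) 1/n (ι C) (ι (2 ℕ.+ m)) ⟩
    1/n * (ι t * ι C * ι (2 ℕ.+ m))      ≡⟨ cong (1/n *_) (trans (ι-* (t ℕ.* C) (2 ℕ.+ m)) (cong (_* ι (2 ℕ.+ m)) (ι-* t C))) ⟨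
    1/n * ι (t ℕ.* C ℕ.* (2 ℕ.+ m))      ≤⟨ *-monoʳ-≤ (0≤/ 1 n) (ι-mono-≤ small) ⟩
    1/n * ι n                            ≡⟨ trans (/-*-ι 1 n) ι-1 ⟩
    1ℚ ∎

  zq≤cy : z * q ≤ ι C * y
  zq≤cy = begin
    z * q                                     ≡⟨ ℚ.*-identityʳ (z * q) ⟨
    -- The inserted 1 = `u` (m+2) supplies the factor m+2 that `tp[m+2]≤1` needs.
    z * q * 1ℚ                                ≡⟨ cong (z * q *_) (/-*-suc (1 ℕ.+ m)) ⟨
    z * q * (u * ι (2 ℕ.+ m))                 ≡⟨ solve 4 (λ z q u w → z :* q :* (u :* w) := z :* u :* (q :* w)) refl z q u (ι (2 ℕ.+ m)) ⟩
    z * u * (q * ι (2 ℕ.+ m))                 ≤⟨ *-monoʳ-≤ (0≤*0≤⇒0≤ 0≤z 0≤u) (*-monoˡ-≤ (0≤ι (2 ℕ.+ m)) (recolourProbability-bound h x j)) ⟩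
    z * u * ((p + ι t * (p * p)) * ι (2 ℕ.+ m)) ≡⟨ cong (z * u *_) (solve 3 (λ p t w → (p :+ t :* (p :* p)) :* w := p :* w :+ p :* (t :* p :* w)) refl p (ι t) (ι (2 ℕ.+ m))) ⟩
    z * u * (p * ι (2 ℕ.+ m) + p * (ι t * p * ι (2 ℕ.+ m))) ≤⟨ *-monoʳ-≤ (0≤*0≤⇒0≤ 0≤z 0≤u) (ℚ.+-monoʳ-≤ (p * ι (2 ℕ.+ m)) (*-monoʳ-≤ 0≤p tp[m+2]≤1)) ⟩
    z * u * (p * ι (2 ℕ.+ m) + p * 1ℚ)        ≡⟨ solve 4 (λ z u p w → z :* u :* (p :* w :+ p :* con 1ℚ) := z :* (con 1ℚ :+ w) :* (u :* p)) refl z u p (ι (2 ℕ.+ m)) ⟩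
    z * (1ℚ + ι (2 ℕ.+ m)) * (u * p)          ≡⟨ cong (λ w → z * w * (u * p)) (ι-suc (2 ℕ.+ m)) ⟨
    z * ι (3 ℕ.+ m) * (u * p)                 ≡⟨ cong₂ (λ a b → a * (u * b)) (/-*-suc (2 ℕ.+ m)) (proportion-def x j) ⟩
    1ℚ * (u * (1/n * ι C))                    ≡⟨ solve 3 (λ u v C → con 1ℚ :* (u :* (v :* C)) := C :* (u :* v)) refl u 1/n (ι C) ⟩
    ι C * y ∎

  ny≡u : ι n * y ≡ u
  ny≡u = trans (solve 3 (λ n u v → n :* (u :* v) := (v :* n) :* u) refl (ι n) u 1/n)
    (trans (cong (_* u) (trans (/-*-ι 1 n) ι-1)) (ℚ.*-identityˡ u))

  [1-u][1+v]≡1 : (1ℚ - u) * (1ℚ + v) ≡ 1ℚ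
  [1-u][1+v]≡1 = begin-equality
    (1ℚ - u) * (1ℚ + v)
      ≡⟨ cong (λ w → (w - u) * (1ℚ + v)) (trans (sym (/-*-suc (1 ℕ.+ m))) (cong (u *_) (ι-suc (1 ℕ.+ m)))) ⟩
    (u * (1ℚ + ι (suc m)) - u) * (1ℚ + v)
      ≡⟨ solve 3 (λ u v w → (u :* (con 1ℚ :+ w) :- u) :* (con 1ℚ :+ v) := u :* (v :* w :+ w)) refl u v (ι (suc m)) ⟩
    u * (v * ι (suc m) + ι (suc m))
      ≡⟨ cong (u *_) (trans (cong (ℚ._+ ι (suc m)) (/-*-suc m)) (sym (ι-suc (suc m)))) ⟩
    u * ι (2 ℕ.+ m)
      ≡⟨ /-*-suc (1 ℕ.+ m) ⟩
    1ℚ ∎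

  [1+y]^n≤βm : (1ℚ + y) ^ n ≤ β m
  [1+y]^n≤βm = begin
    (1ℚ + y) ^ n                           ≡⟨ ℚ.*-identityʳ ((1ℚ + y) ^ n) ⟨
    (1ℚ + y) ^ n * 1ℚ                      ≡⟨ cong ((1ℚ + y) ^ n *_) [1-u][1+v]≡1 ⟨
    (1ℚ + y) ^ n * ((1ℚ - u) * β m)        ≡⟨ ℚ.*-assoc ((1ℚ + y) ^ n) (1ℚ - u) (β m) ⟨
    (1ℚ + y) ^ n * (1ℚ - u) * β m          ≡⟨ cong (λ w → (1ℚ + y) ^ n * (1ℚ - w) * β m) ny≡u ⟨
    (1ℚ + y) ^ n * (1ℚ - ι n * y) * β m    ≤⟨ *-monoˡ-≤ (ℚ.≤-trans 0≤1 (1≤β m)) ([1+a]^n*[1-na]≤1 n 0≤y) ⟩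
    1ℚ * β m                               ≡⟨ ℚ.*-identityˡ (β m) ⟩
    β m ∎

-- The potential along a trajectory

β-antitone : m ℕ.≤ n → β n ≤ β m
β-antitone {m} {n} m≤n = ℚ.+-monoʳ-≤ 1ℚ (*-cancelʳ-≤ {a = + 1 / suc n} {b = + 1 / suc m} (0<ι (suc m)) (begin
  (+ 1 / suc n) * ι (suc m)  ≤⟨ *-monoʳ-≤ (0≤/ 1 (suc n)) (ι-mono-≤ (ℕ.s≤s m≤n)) ⟩
  (+ 1 / suc n) * ι (suc n)  ≡⟨ trans (/-*-suc n) (sym (/-*-suc m)) ⟩
  (+ 1 / suc m) * ι (suc m)  ∎))
  where open ℚ.≤-Reasoning

-- The indicator of τ < m on a finite trajectory; a list that ends early contributes 0. Recursion
-- from the front follows the way `trajectory` prepends the current configuration.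
monochromaticBefore : ∀ n → ℕ → List (Vec ℕ k) → ℚ
monochromaticBefore n zero    ω       = 0ℚ
monochromaticBefore n (suc m) []      = 0ℚ
monochromaticBefore n (suc m) (v ∷ ω) =
  if does (monochromatic? n v) then 1ℚ else monochromaticBefore n m ω

monochromaticBefore≤1 : ∀ n m (ω : List (Vec ℕ k)) → monochromaticBefore n m ω ≤ 1ℚ
monochromaticBefore≤1 n zero    ω       = 0≤1
monochromaticBefore≤1 n (suc m) []      = 0≤1
monochromaticBefore≤1 n (suc m) (v ∷ ω) with does (monochromatic? n v)
... | true  = ℚ.≤-refl
... | false = monochromaticBefore≤1 n m ω

0≤monochromaticBefore : ∀ n m (ω : List (Vec ℕ k)) → 0ℚ ≤ monochromaticBefore n m ω
0≤monochromaticBefore n zero    ω       = ℚ.≤-refl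
0≤monochromaticBefore n (suc m) []      = ℚ.≤-refl
0≤monochromaticBefore n (suc m) (v ∷ ω) with does (monochromatic? n v)
... | true  = 0≤1
... | false = 0≤monochromaticBefore n m ω

monochromaticBefore-skip :
  ∀ m (v : Vec ℕ k) ω → ¬ Monochromatic n v →
  monochromaticBefore n (suc m) (v ∷ ω) ≡ monochromaticBefore n m ω
monochromaticBefore-skip {n = n} m v ω ¬mono =
  cong (if_then 1ℚ else monochromaticBefore n m ω) (dec-false (monochromatic? n v) ¬mono)

monochromaticBefore-findIndex :
  ∀ m (ω : List (Vec ℕ k)) {i} → List.findIndex (monochromatic? n) ω ≡ just i →
  toℕ i ℕ.< m → monochromaticBefore n m ω ≡ 1ℚ
monochromaticBefore-findIndex {n = n} (suc m) (v ∷ ω) found i<m with does (monochromatic? n v)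
... | true = refl
... | false with List.findIndex (monochromatic? n) ω in eq
monochromaticBefore-findIndex {n = n} (suc m) (v ∷ ω) refl (ℕ.s≤s i<m) | false | just _ =
  monochromaticBefore-findIndex m ω eq i<m

-- Replaces the rational threshold `b` by a number of rounds `N` that covers every round before `b`:
-- each trajectory is late or is monochromatic among its first `N` entries.
1-Pr[τ≥]≤ : ∀ n b N → (∀ t → ¬ (b ≤ + t / 1) → t ℕ.< N) → (r : Rand (List (Vec ℕ k))) →
            1ℚ - Pr r (τ≥? n b) ≤ expectation r (monochromaticBefore n N)
1-Pr[τ≥]≤ n b N early r = begin
  1ℚ - Pr r (τ≥? n b)
    ≡⟨ cong (_- Pr r (τ≥? n b)) (expectation-const r 1ℚ) ⟨
  expectation r (λ _ → 1ℚ) - Pr r (τ≥? n b)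
    ≤⟨ ℚ.+-monoˡ-≤ (- Pr r (τ≥? n b)) (expectation-mono-≤ r cover) ⟩
  expectation r (λ ω → 𝟙 (does (τ≥? n b ω)) + monochromaticBefore n N ω) - Pr r (τ≥? n b)
    ≡⟨ cong (_- Pr r (τ≥? n b)) (expectation-+ r (λ ω → 𝟙 (does (τ≥? n b ω))) (monochromaticBefore n N)) ⟩
  Pr r (τ≥? n b) + expectation r (monochromaticBefore n N) - Pr r (τ≥? n b)
    ≡⟨ solve 2 (λ p e → p :+ e :- p := e) refl (Pr r (τ≥? n b)) (expectation r (monochromaticBefore n N)) ⟩
  expectation r (monochromaticBefore n N) ∎
  where
  open ℚ.≤-Reasoning
  found : ∀ ω → ¬ τ≥ n b ω → monochromaticBefore n N ω ≡ 1ℚ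
  found ω ¬late with List.findIndex (monochromatic? n) ω in eq
  -- `nothing` stands for τ = ∞ and therefore counts as late.
  ... | nothing = contradiction MaybeAll.nothing ¬late
  ... | just i  = monochromaticBefore-findIndex N ω eq (early (toℕ i) (λ b≤i → ¬late (MaybeAll.just b≤i)))
  cover : ∀ ω → 1ℚ ≤ 𝟙 (does (τ≥? n b ω)) + monochromaticBefore n N ω
  cover ω with τ≥? n b ω
  ... | yes _     = a≤a+b (0≤monochromaticBefore n N ω)
  ... | no ¬late  = subst (λ z → 1ℚ ≤ 0ℚ + z) (sym (found ω ¬late)) ℚ.≤-refl

monochromatic⇒occurrences : (x : Colouring n k) → Monochromatic n (configuration x) →
                            ∃[ j ] occurrences x j ≡ n
monochromatic⇒occurrences x (j , eq) = j , trans (sym (lookup∘tabulate (occurrences x) j)) eq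

module _ (h : ℕ) .{{_ : NonZero h}} {n : ℕ} .{{_ : NonZero n}} where

  -- The Markov property at the first round: the start is not monochromatic, so the event concerns
  -- only the trajectory restarted from the next colouring, with one round fewer to inspect.
  expectation-trajectory-suc :
    ∀ (x : Colouring n k) T m → ¬ Monochromatic n (configuration x) →
    expectation (trajectory h x (suc T)) (monochromaticBefore n (suc m)) ≡
    expectation (pluralityRound h x) (λ y → expectation (trajectory h y T) (monochromaticBefore n m))
  expectation-trajectory-suc x T m ¬mono = trans
    (expectation->>= (pluralityRound h x) (λ y → trajectory h y T >>= λ ω → pure (configuration x ∷ ω))
      (monochromaticBefore n (suc m)))
    (expectation-cong (pluralityRound h x) (λ y → trans
      (expectation->>= (trajectory h y T) (λ ω → pure (configuration x ∷ ω)) (monochromaticBefore n (suc m)))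
      (expectation-cong (trajectory h y T) (λ ω → monochromaticBefore-skip m (configuration x) ω ¬mono))))

  expectation-monochromaticBefore-1 :
    ∀ (x : Colouring n k) T → ¬ Monochromatic n (configuration x) →
    expectation (trajectory h x T) (monochromaticBefore n 1) ≡ 0ℚ
  expectation-monochromaticBefore-1 x zero    ¬mono = monochromaticBefore-skip 0 (configuration x) [] ¬mono
  expectation-monochromaticBefore-1 x (suc T) ¬mono = trans (expectation-trajectory-suc x T 0 ¬mono)
    (trans (expectation-cong (pluralityRound h x) (λ y → expectation-const (trajectory h y T) 0ℚ))
           (expectation-const (pluralityRound h x) 0ℚ))

  -- The potential Σⱼ (β s)^cⱼ, with s lowered by 2 for each remaining round, is a
  -- supermartingale for as long as no colour reaches D; once one does, the
  -- potential is already at least (β R)^D and the bound is trivial.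
  potential-bound :
    ∀ {R D} → D ℕ.≤ n → (∀ {i} → i ℕ.< D → triangular h ℕ.* i ℕ.* R ℕ.≤ n) →
    ∀ m s → m ℕ.* 2 ℕ.+ s ≡ R → ∀ (x : Colouring n k) T →
    β R ^ D * expectation (trajectory h x T) (monochromaticBefore n m) ≤
    ∑ (λ j → β s ^ occurrences x j)
  potential-bound {k} {R} {D} D≤n small = go
    where
    open ℚ.≤-Reasoning
    0≤β : ∀ s → 0ℚ ≤ β s
    0≤β s = ℚ.≤-trans 0≤1 (1≤β s)
    0≤potential : ∀ s (x : Colouring n k) j → 0ℚ ≤ β s ^ occurrences x j
    0≤potential s x j = 0≤^ (occurrences x j) (0≤β s)
    go : ∀ m s → m ℕ.* 2 ℕ.+ s ≡ R → ∀ (x : Colouring n k) T →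
         β R ^ D * expectation (trajectory h x T) (monochromaticBefore n m) ≤
         ∑ (λ j → β s ^ occurrences x j)
    go zero s eq x T = begin
      β R ^ D * expectation (trajectory h x T) (λ _ → 0ℚ)
        ≡⟨ trans (cong (β R ^ D *_) (expectation-const (trajectory h x T) 0ℚ)) (ℚ.*-zeroʳ (β R ^ D)) ⟩
      0ℚ
        ≤⟨ 0≤sum (0≤potential s x) ⟩
      ∑ (λ j → β s ^ occurrences x j) ∎
    go (suc m) s eq x T with Fin.any? (λ j → D ℕ.≤? occurrences x j)
    ... | yes (j , D≤cⱼ) = begin
      β R ^ D * expectation (trajectory h x T) (monochromaticBefore n (suc m))
        ≤⟨ *-monoʳ-≤ (0≤^ D (0≤β R)) (expectation-mono-≤ (trajectory h x T) (monochromaticBefore≤1 n (suc m))) ⟩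
      β R ^ D * expectation (trajectory h x T) (λ _ → 1ℚ)
        ≡⟨ trans (cong (β R ^ D *_) (expectation-const (trajectory h x T) 1ℚ)) (ℚ.*-identityʳ (β R ^ D)) ⟩
      β R ^ D
        ≤⟨ ^-monoˡ-≤ D (0≤β R) (β-antitone (subst (s ℕ.≤_) eq (ℕ.m≤n+m s _))) ⟩
      β s ^ D
        ≤⟨ ^-monoʳ-≤ (1≤β s) D≤cⱼ ⟩
      β s ^ occurrences x j
        ≤⟨ term≤sum (0≤potential s x) j ⟩
      ∑ (λ j → β s ^ occurrences x j) ∎
    ... | no ¬big = continue T
      where
      ¬mono : ¬ Monochromatic n (configuration x)
      ¬mono mono = let (j , cⱼ≡n) = monochromatic⇒occurrences x mono in
                   ¬big (j , subst (D ℕ.≤_) (sym cⱼ≡n) D≤n)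
      -- The smallness hypothesis is stated once, for `R`; the invariant 2m + s = R passes it on to
      -- the index of this round.
      2+s≤R : 2 ℕ.+ s ℕ.≤ R
      2+s≤R = subst (2 ℕ.+ s ℕ.≤_) eq (ℕ.s≤s (ℕ.s≤s (ℕ.m≤n+m s (m ℕ.* 2))))
      small′ : ∀ j → triangular h ℕ.* occurrences x j ℕ.* (2 ℕ.+ s) ℕ.≤ n
      small′ j = ℕ.≤-trans (ℕ.*-monoʳ-≤ (triangular h ℕ.* occurrences x j) 2+s≤R)
                           (small (ℕ.≰⇒> (λ D≤cⱼ → ¬big (j , D≤cⱼ))))
      continue : ∀ T → β R ^ D * expectation (trajectory h x T) (monochromaticBefore n (suc m)) ≤
                       ∑ (λ j → β s ^ occurrences x j)
      -- The trajectory ends here without a monochromatic configuration, although more rounds could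
      -- be inspected.
      continue zero = begin
        β R ^ D * monochromaticBefore n (suc m) (configuration x ∷ [])
          ≡⟨ trans (cong (β R ^ D *_) (trans (monochromaticBefore-skip m (configuration x) [] ¬mono) (empty m))) (ℚ.*-zeroʳ (β R ^ D)) ⟩
        0ℚ
          ≤⟨ 0≤sum (0≤potential s x) ⟩
        ∑ (λ j → β s ^ occurrences x j) ∎
        where
        empty : ∀ m → monochromaticBefore {k} n m [] ≡ 0ℚ
        empty zero    = refl
        empty (suc m) = refl
      continue (suc T) = begin
        β R ^ D * expectation (trajectory h x (suc T)) (monochromaticBefore n (suc m))
          ≡⟨ trans (cong (β R ^ D *_) (expectation-trajectory-suc x T m ¬mono))
               (sym (expectation-*ˡ (pluralityRound h x) (β R ^ D)
                 (λ y → expectation (trajectory h y T) (monochromaticBefore n m)))) ⟩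
        expectation (pluralityRound h x)
          (λ y → β R ^ D * expectation (trajectory h y T) (monochromaticBefore n m))
          -- One remaining round fewer raises the index by 2, which keeps the invariant;
          -- `round-bound` then brings it back down to `s`.
          ≤⟨ expectation-mono-≤ (pluralityRound h x) (λ y → go m (2 ℕ.+ s) eq′ y T) ⟩
        expectation (pluralityRound h x) (λ y → ∑ (λ j → β (2 ℕ.+ s) ^ occurrences y j))
          ≡⟨ expectation-sum (pluralityRound h x) (λ j y → β (2 ℕ.+ s) ^ occurrences y j) ⟩
        ∑ (λ j → expectation (pluralityRound h x) (λ y → β (2 ℕ.+ s) ^ occurrences y j))
          ≤⟨ sum-mono-≤ (λ j → round-bound h x j s (small′ j)) ⟩
        ∑ (λ j → β s ^ occurrences x j) ∎
        where
        eq′ : m ℕ.* 2 ℕ.+ (2 ℕ.+ s) ≡ R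
        eq′ = trans (trans (ℕ.+-suc (m ℕ.* 2) (1 ℕ.+ s)) (cong suc (ℕ.+-suc (m ℕ.* 2) s))) eq

-- Growth of natural powers

n*o≤m⇒n≤m/o : ∀ {m n o} .{{_ : NonZero o}} → n ℕ.* o ℕ.≤ m → n ℕ.≤ m ℕ./ o
n*o≤m⇒n≤m/o {m} {n} {o} n*o≤m = subst (ℕ._≤ m ℕ./ o) (ℕ.m*n/n≡m n o) (ℕ./-monoˡ-≤ o n*o≤m)

m<[1+m/n]*n : ∀ m n .{{_ : NonZero n}} → m ℕ.< suc (m ℕ./ n) ℕ.* n
m<[1+m/n]*n m n = ℕ.≰⇒> λ le → ℕ.<-irrefl refl (n*o≤m⇒n≤m/o le)

ℕ-^-distribʳ-* : ∀ m n o → (m ℕ.* n) ℕ.^ o ≡ m ℕ.^ o ℕ.* n ℕ.^ o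
ℕ-^-distribʳ-* m n zero    = refl
ℕ-^-distribʳ-* m n (suc o) = trans (cong (m ℕ.* n ℕ.*_) (ℕ-^-distribʳ-* m n o))
  (ℕ-Solver.solve 4 (λ m n a b → m ⊛ n ⊛ (a ⊛ b) ≐ m ⊛ a ⊛ (n ⊛ b)) refl m n (m ℕ.^ o) (n ℕ.^ o))

^-swap : ∀ m n o → (m ℕ.^ n) ℕ.^ o ≡ (m ℕ.^ o) ℕ.^ n
^-swap m n o = trans (ℕ.^-*-assoc m n o) (trans (cong (m ℕ.^_) (ℕ.*-comm n o)) (sym (ℕ.^-*-assoc m o n)))

m≤m^n : ∀ m n .{{_ : NonZero n}} → m ℕ.≤ m ℕ.^ n
m≤m^n zero      n       = ℕ.z≤n
m≤m^n m@(suc _) (suc n) = ℕ.m≤m*n m (m ℕ.^ n) {{ℕ.m^n≢0 m n}}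

1+n≤2^n : ∀ n → suc n ℕ.≤ 2 ℕ.^ n
1+n≤2^n zero    = ℕ.≤-refl
1+n≤2^n (suc n) = ℕ.+-mono-≤ (ℕ.m^n>0 2 n) (subst (suc n ℕ.≤_) (sym (ℕ.+-identityʳ (2 ℕ.^ n))) (1+n≤2^n n))

-- With e = 2d and q = ⌊m/e⌋, m + 1 ≤ (q+1)e ≤ 2^(q+e). Raised to the power d the exponent is qd +
-- 2d², and both summands are at most m/2.
polynomial≤exponential : ∀ d .{{_ : NonZero d}} {m} → 4 ℕ.* (d ℕ.* d) ℕ.≤ m → suc m ℕ.^ d ℕ.≤ 2 ℕ.^ m
polynomial≤exponential d {m} 4d²≤m = begin
  suc m ℕ.^ d                       ≤⟨ ℕ.^-monoˡ-≤ d (m<[1+m/n]*n m e) ⟩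
  (suc (m ℕ./ e) ℕ.* e) ℕ.^ d       ≤⟨ ℕ.^-monoˡ-≤ d (ℕ.*-mono-≤ (1+n≤2^n (m ℕ./ e))
    (ℕ.≤-trans (ℕ.n≤1+n e) (1+n≤2^n e))) ⟩
  (2 ℕ.^ (m ℕ./ e) ℕ.* 2 ℕ.^ e) ℕ.^ d  ≡⟨ cong (ℕ._^ d) (ℕ.^-distribˡ-+-* 2 (m ℕ./ e) e) ⟨
  (2 ℕ.^ (m ℕ./ e ℕ.+ e)) ℕ.^ d     ≡⟨ ℕ.^-*-assoc 2 (m ℕ./ e ℕ.+ e) d ⟩
  2 ℕ.^ ((m ℕ./ e ℕ.+ e) ℕ.* d)     ≤⟨ ℕ.^-monoʳ-≤ 2 exponent≤m ⟩
  2 ℕ.^ m                           ∎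
  where
  open ℕ.≤-Reasoning
  e = 2 ℕ.* d
  instance
    e≢0 : NonZero e
    e≢0 = ℕ.m*n≢0 2 d
  exponent≤m : (m ℕ./ e ℕ.+ e) ℕ.* d ℕ.≤ m
  exponent≤m = ℕ.*-cancelˡ-≤ 2 (begin
    2 ℕ.* ((m ℕ./ e ℕ.+ e) ℕ.* d)
      ≡⟨ ℕ-Solver.solve 2 (λ q d → lit 2 ⊛ ((q ⊞ lit 2 ⊛ d) ⊛ d) ≐ q ⊛ (lit 2 ⊛ d) ⊞ lit 4 ⊛ (d ⊛ d))
           refl (m ℕ./ e) d ⟩
    m ℕ./ e ℕ.* e ℕ.+ 4 ℕ.* (d ℕ.* d)
      ≤⟨ ℕ.+-mono-≤ (ℕ.m/n*n≤m m e) 4d²≤m ⟩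
    m ℕ.+ m
      ≡⟨ ℕ-Solver.solve 1 (λ m → m ⊞ m ≐ lit 2 ⊛ m) refl m ⟩
    2 ℕ.* m ∎)

2*triangular≤square : ∀ h → 2 ℕ.* triangular h ℕ.≤ h ℕ.* h
2*triangular≤square zero    = ℕ.z≤n
2*triangular≤square (suc h) = begin
  2 ℕ.* (h ℕ.+ triangular h)        ≡⟨ ℕ.*-distribˡ-+ 2 h (triangular h) ⟩
  2 ℕ.* h ℕ.+ 2 ℕ.* triangular h    ≤⟨ ℕ.+-monoʳ-≤ (2 ℕ.* h) (2*triangular≤square h) ⟩
  2 ℕ.* h ℕ.+ h ℕ.* h               ≤⟨ ℕ.n≤1+n _ ⟩
  suc (2 ℕ.* h ℕ.+ h ℕ.* h)         ≡⟨ ℕ-Solver.solve 1 (λ h → lit 1 ⊞ (lit 2 ⊛ h ⊞ h ⊛ h)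
                                         ≐ (lit 1 ⊞ h) ⊛ (lit 1 ⊞ h)) refl h ⟩
  suc h ℕ.* suc h                   ∎
  where
  open ℕ.≤-Reasoning

-- Supplies 4N ≤ R for N = 1 + ⌊R/g⌋ with g, R ≥ 8: half of R absorbs the added 1, the other half
-- the quotient.
4[1+m]≤n : ∀ m {n o} → 8 ℕ.≤ o → 8 ℕ.≤ n → m ℕ.* o ℕ.≤ n → 4 ℕ.* suc m ℕ.≤ n
4[1+m]≤n m {n} {o} 8≤o 8≤n mo≤n = ℕ.*-cancelˡ-≤ 2 (begin
  2 ℕ.* (4 ℕ.* suc m)    ≡⟨ ℕ-Solver.solve 1 (λ m → lit 2 ⊛ (lit 4 ⊛ (lit 1 ⊞ m)) ≐ lit 8 ⊞ m ⊛ lit 8) refl m ⟩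
  8 ℕ.+ m ℕ.* 8          ≤⟨ ℕ.+-mono-≤ 8≤n (ℕ.≤-trans (ℕ.*-monoʳ-≤ m 8≤o) mo≤n) ⟩
  n ℕ.+ n                ≡⟨ cong (n ℕ.+_) (ℕ.+-identityʳ n) ⟨
  2 ℕ.* n ∎)
  where open ℕ.≤-Reasoning

-- The lower bound on n: with ⌊n / k²⌋ ≥ n^(1/Q) − 1, this makes 2^⌊n / k²⌋
-- superpolynomial in n.
minimalSize : ℕ → ℕ
minimalSize Q = suc ((4 ℕ.* (Q ℕ.* Q ℕ.* (Q ℕ.* Q))) ℕ.^ Q)

-- The second hypothesis says k² ≤ n^(1 - 1/Q). Hence μ = ⌊n/k²⌋ satisfies n ≤ (1+μ)^Q, so nk ≤ n^Q
-- is at most a polynomial in 1+μ of degree Q², which 2^μ dominates.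
n*k≤2^[n/k²] : ∀ Q .{{_ : NonZero Q}} k .{{_ : NonZero k}} .{{_ : NonZero (k ℕ.* k)}} →
  minimalSize Q ℕ.≤ n → n ℕ.* (k ℕ.* k) ℕ.^ Q ℕ.≤ n ℕ.^ Q →
  n ℕ.* k ℕ.≤ 2 ℕ.^ (n ℕ./ (k ℕ.* k))
n*k≤2^[n/k²] {n} Q k n-large k-small = begin
  n ℕ.* k                     ≤⟨ ℕ.*-monoʳ-≤ n (ℕ.≤-trans (ℕ.m≤m*n k k) (m≤m^n kk Q)) ⟩
  n ℕ.* kk ℕ.^ Q              ≤⟨ k-small ⟩
  n ℕ.^ Q                     ≤⟨ ℕ.^-monoˡ-≤ Q n≤[1+μ]^Q ⟩
  (suc μ ℕ.^ Q) ℕ.^ Q         ≡⟨ ℕ.^-*-assoc (suc μ) Q Q ⟩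
  suc μ ℕ.^ (Q ℕ.* Q)         ≤⟨ polynomial≤exponential (Q ℕ.* Q) {{ℕ.m*n≢0 Q Q}} μ-large ⟩
  2 ℕ.^ μ                     ∎
  where
  open ℕ.≤-Reasoning
  kk = k ℕ.* k
  μ = n ℕ./ kk
  n≤[1+μ]^Q : n ℕ.≤ suc μ ℕ.^ Q
  n≤[1+μ]^Q = ℕ.*-cancelʳ-≤ n (suc μ ℕ.^ Q) (kk ℕ.^ Q) {{ℕ.m^n≢0 kk Q}} (begin
    n ℕ.* kk ℕ.^ Q             ≤⟨ k-small ⟩
    n ℕ.^ Q                    ≤⟨ ℕ.^-monoˡ-≤ Q (ℕ.<⇒≤ (m<[1+m/n]*n n kk)) ⟩
    (suc μ ℕ.* kk) ℕ.^ Q       ≡⟨ ℕ-^-distribʳ-* (suc μ) kk Q ⟩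
    suc μ ℕ.^ Q ℕ.* kk ℕ.^ Q   ∎)
  -- A smaller μ would give n ≤ (4Q⁴)^Q, below `minimalSize`.
  μ-large : 4 ℕ.* (Q ℕ.* Q ℕ.* (Q ℕ.* Q)) ℕ.≤ μ
  μ-large = ℕ.≮⇒≥ λ μ<4d² → ℕ.<-irrefl refl
    (ℕ.≤-trans n-large (ℕ.≤-trans n≤[1+μ]^Q (ℕ.^-monoˡ-≤ Q μ<4d²)))

-- The bound reads k⁴ ≤ (κh)⁴ n^(1 - 1/Q). Since (κh)² ≤ k, the factor (κh)⁴ is at most k², which
-- cancels against half of k⁴.
n*k^2Q≤n^Q : ∀ Q κ k .{{_ : NonZero k}} → (κ ℕ.* κ) ℕ.* (h ℕ.* h) ℕ.≤ k →
  n ℕ.* (k ℕ.^ 4) ℕ.^ Q ℕ.≤ ((κ ℕ.* h) ℕ.^ 4 ℕ.* n) ℕ.^ Q →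
  n ℕ.* (k ℕ.* k) ℕ.^ Q ℕ.≤ n ℕ.^ Q
n*k^2Q≤n^Q {h} {n} Q κ k κ²h²≤k bound =
  ℕ.*-cancelʳ-≤ _ _ (kk ℕ.^ Q) {{ℕ.m^n≢0 kk Q {{ℕ.m*n≢0 k k}}}} (begin
    n ℕ.* kk ℕ.^ Q ℕ.* kk ℕ.^ Q    ≡⟨ ℕ.*-assoc n (kk ℕ.^ Q) (kk ℕ.^ Q) ⟩
    n ℕ.* (kk ℕ.^ Q ℕ.* kk ℕ.^ Q)  ≡⟨ cong (n ℕ.*_) (trans (cong (ℕ._^ Q)
      (ℕ-Solver.solve 1 (λ k → k ⊛ (k ⊛ (k ⊛ (k ⊛ lit 1))) ≐ k ⊛ k ⊛ (k ⊛ k)) refl k)) (ℕ-^-distribʳ-* kk kk Q)) ⟨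
    n ℕ.* (k ℕ.^ 4) ℕ.^ Q          ≤⟨ bound ⟩
    ((κ ℕ.* h) ℕ.^ 4 ℕ.* n) ℕ.^ Q  ≤⟨ ℕ.^-monoˡ-≤ Q (ℕ.*-monoˡ-≤ n (begin
      (κ ℕ.* h) ℕ.^ 4
        ≡⟨ ℕ-Solver.solve 2 (λ κ h → κ ⊛ h ⊛ (κ ⊛ h ⊛ (κ ⊛ h ⊛ (κ ⊛ h ⊛ lit 1)))
             ≐ κ ⊛ κ ⊛ (h ⊛ h) ⊛ (κ ⊛ κ ⊛ (h ⊛ h))) refl κ h ⟩
      κ ℕ.* κ ℕ.* (h ℕ.* h) ℕ.* (κ ℕ.* κ ℕ.* (h ℕ.* h))
        ≤⟨ ℕ.*-mono-≤ κ²h²≤k κ²h²≤k ⟩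
      kk ∎)) ⟩
    (kk ℕ.* n) ℕ.^ Q               ≡⟨ trans (ℕ-^-distribʳ-* kk n Q) (ℕ.*-comm (kk ℕ.^ Q) (n ℕ.^ Q)) ⟩
    n ℕ.^ Q ℕ.* kk ℕ.^ Q           ∎)
  where
  open ℕ.≤-Reasoning
  kk = k ℕ.* k

-- The initial configuration and comparison of the bases

lookup≤maximum : ∀ (v : Vec ℕ k) j → Vec.lookup v j ℕ.≤ maximum v
lookup≤maximum (a ∷ v) zero    = ℕ.m≤m⊔n a (maximum v)
lookup≤maximum (a ∷ v) (suc j) = ℕ.≤-trans (lookup≤maximum v j) (ℕ.m≤n⊔m a (maximum v))

occurrences≤maximum : ∀ (x : Colouring n k) j → occurrences x j ℕ.≤ maximum (configuration x)
occurrences≤maximum x j = subst (ℕ._≤ maximum (configuration x))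
  (lookup∘tabulate (occurrences x) j) (lookup≤maximum (configuration x) j)

¬monochromatic-initially :
  .{{_ : NonZero n}} → 2 ℕ.≤ k → (x : Colouring n k) →
  2 ℕ.* k ℕ.* maximum (configuration x) ℕ.≤ 3 ℕ.* n → ¬ Monochromatic n (configuration x)
¬monochromatic-initially {n} {k} 2≤k x balanced mono = ℕ.<-irrefl refl (begin-strict
  3 ℕ.* n                                  <⟨ ℕ.*-monoˡ-< n (ℕ.n<1+n 3) ⟩
  2 ℕ.* 2 ℕ.* n                            ≤⟨ ℕ.*-mono-≤ (ℕ.*-monoʳ-≤ 2 2≤k) n≤max ⟩
  2 ℕ.* k ℕ.* maximum (configuration x)    ≤⟨ balanced ⟩
  3 ℕ.* n                                  ∎)
  where
  open ℕ.≤-Reasoning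
  n≤max : n ℕ.≤ maximum (configuration x)
  n≤max = let (j , cⱼ≡n) = monochromatic⇒occurrences x mono in
          subst (ℕ._≤ maximum (configuration x)) cⱼ≡n (occurrences≤maximum x j)

-- Passing from `R` to an index of at least R/2 at most doubles the excess of the base over 1, and
-- squaring at least doubles it.
β≤β² : ∀ {s R} → R ℕ.≤ 2 ℕ.* s → β s ≤ β R ^ 2
β≤β² {s} {R} R≤2s = begin
  1ℚ + u                  ≤⟨ ℚ.+-monoʳ-≤ 1ℚ u≤2v ⟩
  1ℚ + ι 2 * v            ≤⟨ bernoulli 2 0≤v ⟩
  (1ℚ + v) ^ 2            ∎
  where
  open ℚ.≤-Reasoning
  u = + 1 / suc s
  v = + 1 / suc R
  0≤u : 0ℚ ≤ u
  0≤u = 0≤/ 1 (suc s)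
  0≤v : 0ℚ ≤ v
  0≤v = 0≤/ 1 (suc R)
  1+R≤2[1+s] : suc R ℕ.≤ 2 ℕ.* suc s
  1+R≤2[1+s] = ℕ.≤-trans (ℕ.s≤s R≤2s) (ℕ.≤-trans (ℕ.n≤1+n _) (ℕ.≤-reflexive (sym (ℕ.*-suc 2 s))))
  u≤2v : u ≤ ι 2 * v
  u≤2v = begin
    u                             ≡⟨ ℚ.*-identityʳ u ⟨
    u * 1ℚ                        ≡⟨ cong (u *_) (/-*-suc R) ⟨
    u * (v * ι (suc R))           ≤⟨ *-monoʳ-≤ 0≤u (*-monoʳ-≤ 0≤v (ι-mono-≤ 1+R≤2[1+s])) ⟩
    u * (v * ι (2 ℕ.* suc s))     ≡⟨ cong (λ w → u * (v * w)) (ι-* 2 (suc s)) ⟩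
    u * (v * (ι 2 * ι (suc s)))   ≡⟨ solve 4 (λ u v t w → u :* (v :* (t :* w)) := u :* w :* (t :* v)) refl u v (ι 2) (ι (suc s)) ⟩
    u * ι (suc s) * (ι 2 * v)     ≡⟨ cong (_* (ι 2 * v)) (/-*-suc s) ⟩
    1ℚ * (ι 2 * v)                ≡⟨ ℚ.*-identityˡ (ι 2 * v) ⟩
    ι 2 * v                       ∎

2^≤β^ : ∀ R m → ι (2 ℕ.^ m) ≤ β R ^ (suc R ℕ.* m)
2^≤β^ R m = begin
  ι (2 ℕ.^ m)              ≡⟨ ι-^ 2 m ⟩
  ι 2 ^ m                  ≤⟨ ^-monoˡ-≤ m (0≤ι 2) 2≤β^ ⟩
  (β R ^ suc R) ^ m        ≡⟨ ^-assocʳ (β R) (suc R) m ⟩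
  β R ^ (suc R ℕ.* m)      ∎
  where
  open ℚ.≤-Reasoning
  2≤β^ : ι 2 ≤ β R ^ suc R
  2≤β^ = begin
    ι 2                                   ≡⟨ trans (ι-suc 1) (cong (1ℚ ℚ.+_) ι-1) ⟩
    1ℚ + 1ℚ                               ≡⟨ cong (1ℚ ℚ.+_) (trans (ℚ.*-comm (ι (suc R)) (+ 1 / suc R)) (/-*-suc R)) ⟨
    1ℚ + ι (suc R) * (+ 1 / suc R)        ≤⟨ bernoulli (suc R) (0≤/ 1 (suc R)) ⟩
    β R ^ suc R                           ∎

-- The failure probability when k/(2h²) is large

module _
  (κ Q : ℕ) .{{_ : NonZero Q}}
  {n : ℕ} .{{_ : NonZero n}} (n-large : minimalSize Q ℕ.≤ n)
  {k h : ℕ} .{{_ : NonZero h}} .{{_ : NonZero k}}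
  (k/h-small : n ℕ.* (k ℕ.^ 4) ℕ.^ Q ℕ.≤ ((κ ℕ.* h) ℕ.^ 4 ℕ.* n) ℕ.^ Q)
  (x : Colouring n k) (balanced : 2 ℕ.* k ℕ.* maximum (configuration x) ℕ.≤ 3 ℕ.* n)
  (T : ℕ) {R : ℕ} (N : ℕ) (8≤R : 8 ℕ.≤ R) (κ²≤R : κ ℕ.* κ ℕ.≤ R)
  (RH≤k : R ℕ.* (2 ℕ.* (h ℕ.* h)) ℕ.≤ k) (4N≤R : 4 ℕ.* N ℕ.≤ R)
  where

  private
    H = 2 ℕ.* (h ℕ.* h)
    kk = k ℕ.* k
    instance
      kk≢0 : NonZero kk
      kk≢0 = ℕ.m*n≢0 k k
    -- The index of the potential at round 0: `R` lowered by 2 for each of `N` rounds.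
    s = R ℕ.∸ N ℕ.* 2
    M = maximum (configuration x)
    -- One more than ⌊4n/k⌋: every i < D has ik ≤ 4n, as the drift estimate needs, while kD ≥ 4n.
    D : ℕ
    D = suc (4 ℕ.* n ℕ./ k)
    -- The exponent left over once the initial potential has used up 2M; balance makes it at least
    -- n/k.
    L = D ℕ.∸ 2 ℕ.* M
    μ = n ℕ./ kk

    module _ where
      open ℕ.≤-Reasoning

      2R≤k : 2 ℕ.* R ℕ.≤ k
      2R≤k = begin
        2 ℕ.* R              ≤⟨ ℕ.m≤m*n (2 ℕ.* R) (h ℕ.* h) {{ℕ.m*n≢0 h h}} ⟩
        2 ℕ.* R ℕ.* (h ℕ.* h) ≡⟨ ℕ-Solver.solve 2 (λ R h → lit 2 ⊛ R ⊛ (h ⊛ h) ≐ R ⊛ (lit 2 ⊛ (h ⊛ h))) refl R h ⟩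
        R ℕ.* H              ≤⟨ RH≤k ⟩
        k ∎

      2N+s≡R : N ℕ.* 2 ℕ.+ s ≡ R
      2N+s≡R = ℕ.m+[n∸m]≡n (begin
        N ℕ.* 2   ≤⟨ ℕ.*-monoʳ-≤ N (ℕ.m≤m+n 2 2) ⟩
        N ℕ.* 4   ≡⟨ ℕ.*-comm N 4 ⟩
        4 ℕ.* N   ≤⟨ 4N≤R ⟩
        R ∎)

      R≤2s : R ℕ.≤ 2 ℕ.* s
      R≤2s = ℕ.+-cancelˡ-≤ R R (2 ℕ.* s) (begin
        R ℕ.+ R                         ≡⟨ cong₂ ℕ._+_ 2N+s≡R 2N+s≡R ⟨
        (N ℕ.* 2 ℕ.+ s) ℕ.+ (N ℕ.* 2 ℕ.+ s) ≡⟨ ℕ-Solver.solve 2 (λ N s → (N ⊛ lit 2 ⊞ s) ⊞ (N ⊛ lit 2 ⊞ s) ≐ lit 4 ⊛ N ⊞ lit 2 ⊛ s) refl N s ⟩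
        4 ℕ.* N ℕ.+ 2 ℕ.* s             ≤⟨ ℕ.+-monoˡ-≤ (2 ℕ.* s) 4N≤R ⟩
        R ℕ.+ 2 ℕ.* s ∎)

      D≤n : D ℕ.≤ n
      D≤n = ℕ.m<n*o⇒m/o<n (begin-strict
        4 ℕ.* n   <⟨ ℕ.*-monoˡ-< n (begin-strict
          4         <⟨ ℕ.m≤m+n 5 3 ⟩
          8         ≤⟨ 8≤R ⟩
          R         ≤⟨ ℕ.m≤n*m R 2 ⟩
          2 ℕ.* R   ≤⟨ 2R≤k ⟩
          k ∎) ⟩
        k ℕ.* n   ≡⟨ ℕ.*-comm k n ⟩
        n ℕ.* k ∎)

      -- From ik ≤ 4n, 2C(h,2) ≤ h² and 2h²R ≤ k: C(h,2) · R · ik ≤ nR · 4C(h,2) ≤ nR · 2h² ≤ nk.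
      small : ∀ {i} → i ℕ.< D → triangular h ℕ.* i ℕ.* R ℕ.≤ n
      small {i} (ℕ.s≤s i≤4n/k) = ℕ.*-cancelʳ-≤ _ n k (begin
        t ℕ.* i ℕ.* R ℕ.* k                ≡⟨ ℕ-Solver.solve 4 (λ t i R k → t ⊛ i ⊛ R ⊛ k ≐ t ⊛ R ⊛ (i ⊛ k)) refl t i R k ⟩
        t ℕ.* R ℕ.* (i ℕ.* k)              ≤⟨ ℕ.*-monoʳ-≤ (t ℕ.* R) (ℕ.≤-trans (ℕ.*-monoˡ-≤ k i≤4n/k) (ℕ.m/n*n≤m (4 ℕ.* n) k)) ⟩
        t ℕ.* R ℕ.* (4 ℕ.* n)              ≡⟨ ℕ-Solver.solve 3 (λ t R n → t ⊛ R ⊛ (lit 4 ⊛ n) ≐ n ⊛ (R ⊛ (lit 2 ⊛ (lit 2 ⊛ t)))) refl t R n ⟩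
        n ℕ.* (R ℕ.* (2 ℕ.* (2 ℕ.* t)))    ≤⟨ ℕ.*-monoʳ-≤ n (ℕ.*-monoʳ-≤ R (ℕ.*-monoʳ-≤ 2 (2*triangular≤square h))) ⟩
        n ℕ.* (R ℕ.* H)                    ≤⟨ ℕ.*-monoʳ-≤ n RH≤k ⟩
        n ℕ.* k ∎)
        where
        t = triangular h

      k[2M]≤3n : k ℕ.* (2 ℕ.* M) ℕ.≤ 3 ℕ.* n
      k[2M]≤3n = subst (ℕ._≤ 3 ℕ.* n)
        (ℕ-Solver.solve 2 (λ k M → lit 2 ⊛ k ⊛ M ≐ k ⊛ (lit 2 ⊛ M)) refl k M) balanced

      4n≤kD : 4 ℕ.* n ℕ.≤ k ℕ.* D
      4n≤kD = subst (4 ℕ.* n ℕ.≤_) (ℕ.*-comm D k) (ℕ.<⇒≤ (m<[1+m/n]*n (4 ℕ.* n) k))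

      2M+L≡D : 2 ℕ.* M ℕ.+ L ≡ D
      2M+L≡D = ℕ.m+[n∸m]≡n (ℕ.*-cancelˡ-≤ k
        (ℕ.≤-trans k[2M]≤3n (ℕ.≤-trans (ℕ.*-monoˡ-≤ n (ℕ.n≤1+n 3)) 4n≤kD)))

      n≤kL : n ℕ.≤ k ℕ.* L
      n≤kL = ℕ.+-cancelˡ-≤ (3 ℕ.* n) n (k ℕ.* L) (begin
        3 ℕ.* n ℕ.+ n                  ≡⟨ ℕ.+-comm (3 ℕ.* n) n ⟩
        4 ℕ.* n                        ≤⟨ 4n≤kD ⟩
        k ℕ.* D                        ≡⟨ trans (cong (k ℕ.*_) (sym 2M+L≡D)) (ℕ.*-distribˡ-+ k (2 ℕ.* M) L) ⟩
        k ℕ.* (2 ℕ.* M) ℕ.+ k ℕ.* L    ≤⟨ ℕ.+-monoˡ-≤ (k ℕ.* L) k[2M]≤3n ⟩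
        3 ℕ.* n ℕ.+ k ℕ.* L ∎)

      [1+R]μ≤L : suc R ℕ.* μ ℕ.≤ L
      [1+R]μ≤L = ℕ.≤-trans (ℕ.*-monoˡ-≤ μ 1+R≤k) (ℕ.*-cancelˡ-≤ k (begin
        k ℕ.* (k ℕ.* μ)     ≡⟨ trans (sym (ℕ.*-assoc k k μ)) (ℕ.*-comm kk μ) ⟩
        μ ℕ.* kk            ≤⟨ ℕ.m/n*n≤m n kk ⟩
        n                   ≤⟨ n≤kL ⟩
        k ℕ.* L ∎))
        where
        1+R≤k : suc R ℕ.≤ k
        1+R≤k = begin
          1 ℕ.+ R           ≤⟨ ℕ.+-monoˡ-≤ R (ℕ.≤-trans (ℕ.s≤s ℕ.z≤n) 8≤R) ⟩
          R ℕ.+ R           ≡⟨ cong (R ℕ.+_) (ℕ.+-identityʳ R) ⟨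
          2 ℕ.* R           ≤⟨ 2R≤k ⟩
          k ∎

      κ²h²≤k : (κ ℕ.* κ) ℕ.* (h ℕ.* h) ℕ.≤ k
      κ²h²≤k = begin
        (κ ℕ.* κ) ℕ.* (h ℕ.* h)   ≤⟨ ℕ.*-mono-≤ κ²≤R (ℕ.m≤n*m (h ℕ.* h) 2) ⟩
        R ℕ.* H                   ≤⟨ RH≤k ⟩
        k ∎

      nk≤2^μ : n ℕ.* k ℕ.≤ 2 ℕ.^ μ
      nk≤2^μ = n*k≤2^[n/k²] Q k n-large (n*k^2Q≤n^Q Q κ k κ²h²≤k k/h-small)

  -- Both sides are scaled by k (β R)^(2M), so nothing is divided. As nk ≤ 2^μ ≤ (β R)^L and 2M + L
  -- = D, the left side is at most (β R)^D times the early probability, which the initial potential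
  -- bounds.
  early-probability*n≤1 :
    expectation (trajectory h x T) (monochromaticBefore n N) * ι n ≤ 1ℚ
  early-probability*n≤1 = *-cancelʳ-≤ (0<ι k) (*-cancelˡ-≤ (0<^ (2 ℕ.* M) 0<βR) (begin
    βR ^ (2 ℕ.* M) * (F * ι n * ι k)
      ≡⟨ cong (βR ^ (2 ℕ.* M) *_) (trans (ℚ.*-assoc F (ι n) (ι k)) (cong (F *_) (sym (ι-* n k)))) ⟩
    βR ^ (2 ℕ.* M) * (F * ι (n ℕ.* k))
      ≤⟨ *-monoʳ-≤ (0≤^ (2 ℕ.* M) 0≤βR) (*-monoʳ-≤ 0≤F nk≤β^L) ⟩
    βR ^ (2 ℕ.* M) * (F * βR ^ L)
      ≡⟨ solve 3 (λ a f b → a :* (f :* b) := a :* b :* f) refl (βR ^ (2 ℕ.* M)) F (βR ^ L) ⟩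
    βR ^ (2 ℕ.* M) * βR ^ L * F
      ≡⟨ cong (_* F) (trans (sym (^-homo-* βR (2 ℕ.* M) L)) (cong (βR ^_) 2M+L≡D)) ⟩
    βR ^ D * F
      ≤⟨ potential-bound h D≤n small N s 2N+s≡R x T ⟩
    ∑ (λ j → βs ^ occurrences x j)
      -- Each of the `k` colours has at most `M` nodes, and β s ≤ (β R)² because 4N ≤ R keeps `s` at
      -- or above R/2.
      ≤⟨ sum-mono-≤ (λ j → ℚ.≤-trans (^-monoʳ-≤ (1≤β s) (occurrences≤maximum x j))
           (^-monoˡ-≤ M (ℚ.≤-trans 0≤1 (1≤β s)) (β≤β² {s} {R} R≤2s))) ⟩
    ∑ {k} (λ j → (βR ^ 2) ^ M)
      ≡⟨ trans (sum-const k ((βR ^ 2) ^ M)) (cong (ι k *_) (^-assocʳ βR 2 M)) ⟩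
    ι k * βR ^ (2 ℕ.* M)
      ≡⟨ solve 2 (λ a b → a :* b := b :* (con 1ℚ :* a)) refl (ι k) (βR ^ (2 ℕ.* M)) ⟩
    βR ^ (2 ℕ.* M) * (1ℚ * ι k) ∎))
    where
    open ℚ.≤-Reasoning
    βR = β R
    βs = β s
    F = expectation (trajectory h x T) (monochromaticBefore n N)
    0<βR : 0ℚ < βR
    0<βR = ℚ.<-≤-trans 0<1 (1≤β R)
    0≤βR : 0ℚ ≤ βR
    0≤βR = ℚ.<⇒≤ 0<βR
    0≤F : 0ℚ ≤ F
    0≤F = 0≤expectation (trajectory h x T) (0≤monochromaticBefore n N)
    nk≤β^L : ι (n ℕ.* k) ≤ βR ^ L
    nk≤β^L = ℚ.≤-trans (ι-mono-≤ nk≤2^μ)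
      (ℚ.≤-trans (2^≤β^ R μ) (^-monoʳ-≤ (1≤β R) [1+R]μ≤L))

-- Large and small thresholds

module _
  (g κ Q : ℕ) .{{_ : NonZero Q}} (8≤g : 8 ℕ.≤ g) (κ²≤g : κ ℕ.* κ ℕ.≤ g)
  {n : ℕ} .{{_ : NonZero n}} (n-large : minimalSize Q ℕ.≤ n)
  {k h : ℕ} .{{_ : NonZero h}} (2≤k : 2 ℕ.≤ k)
  (k/h-small : n ℕ.* (k ℕ.^ 4) ℕ.^ Q ℕ.≤ ((κ ℕ.* h) ℕ.^ 4 ℕ.* n) ℕ.^ Q)
  (x : Colouring n k) (balanced : 2 ℕ.* k ℕ.* maximum (configuration x) ℕ.≤ 3 ℕ.* n)
  (T : ℕ)
  where

  private
    H = 2 ℕ.* (h ℕ.* h)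
    instance
      H≢0 : NonZero H
      H≢0 = ℕ.m*n≢0 2 (h ℕ.* h) {{_}} {{ℕ.m*n≢0 h h}}
      k≢0 : NonZero k
      k≢0 = ℕ.>-nonZero (ℕ.≤-trans (ℕ.s≤s ℕ.z≤n) 2≤k)
      g≢0 : NonZero g
      g≢0 = ℕ.>-nonZero (ℕ.≤-trans (ℕ.s≤s ℕ.z≤n) 8≤g)
    R = k ℕ./ H

  -- Rounds before `b` satisfy tg ≤ R = ⌊k/(2h²)⌋. If g ≤ R, the potential argument covers them;
  -- otherwise the only such round is t = 0.
  1-Pr[τ≥]*n≤1 : ∀ b → (∀ t → ¬ (b ≤ + t / 1) → t ℕ.* g ℕ.* H ℕ.< k) →
                 (1ℚ - Pr (trajectory h x T) (τ≥? n b)) * ι n ≤ 1ℚ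
  1-Pr[τ≥]*n≤1 b early = byCase (g ℕ.≤? R)
    where
    open ℚ.≤-Reasoning
    tg≤R : ∀ t → ¬ (b ≤ + t / 1) → t ℕ.* g ℕ.≤ R
    tg≤R t t<b = n*o≤m⇒n≤m/o (ℕ.<⇒≤ (early t t<b))
    first : ¬ g ℕ.≤ R → ∀ t → t ℕ.* g ℕ.≤ R → t ℕ.< 1
    first g≰R zero    _    = ℕ.s≤s ℕ.z≤n
    first g≰R (suc t) tg≤R = contradiction (ℕ.≤-trans (ℕ.m≤m+n g (t ℕ.* g)) tg≤R) g≰R
    byCase : Dec (g ℕ.≤ R) → (1ℚ - Pr (trajectory h x T) (τ≥? n b)) * ι n ≤ 1ℚ
    -- Rounds 0 to ⌊R/g⌋ must all be inspected, so N = 1 + ⌊R/g⌋.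
    byCase (yes g≤R) = ℚ.≤-trans
      (*-monoˡ-≤ (0≤ι n) (1-Pr[τ≥]≤ n b (suc (R ℕ./ g)) (λ t t<b → ℕ.s≤s (n*o≤m⇒n≤m/o (tg≤R t t<b))) (trajectory h x T)))
      (early-probability*n≤1 κ Q n-large k/h-small x balanced T
        (suc (R ℕ./ g)) 8≤R (ℕ.≤-trans κ²≤g g≤R) (ℕ.m/n*n≤m k H) (4[1+m]≤n (R ℕ./ g) 8≤g 8≤R (ℕ.m/n*n≤m R g)))
      where
      8≤R = ℕ.≤-trans 8≤g g≤R
    -- Only the initial configuration is inspected, and balance with k ≥ 2 prevents it from being
    -- monochromatic, so the failure probability is 0.
    byCase (no g≰R) = begin
      (1ℚ - Pr (trajectory h x T) (τ≥? n b)) * ι n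
        ≤⟨ *-monoˡ-≤ (0≤ι n) (1-Pr[τ≥]≤ n b 1 (λ t t<b → first g≰R t (tg≤R t t<b)) (trajectory h x T)) ⟩
      expectation (trajectory h x T) (monochromaticBefore n 1) * ι n
        ≡⟨ cong (_* ι n) (expectation-monochromaticBefore-1 h x T (¬monochromatic-initially 2≤k x balanced)) ⟩
      0ℚ * ι n
        ≡⟨ ℚ.*-zeroˡ (ι n) ⟩
      0ℚ
        ≤⟨ 0≤1 ⟩
      1ℚ ∎

-- Reading the hypotheses and the conclusion in ℕ

archimedean : ∀ q → ∃[ κ ] q ≤ ι κ
archimedean q@(mkℚ -[1+ _ ] _ _) = 0 , ℚ.≤-trans (ℚ.nonPositive⁻¹ q) (0≤ι 0)
archimedean q@(mkℚ (+ p) d _) = p , (begin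
  q                              ≡⟨ ℚ.*-identityʳ q ⟨
  q * 1ℚ                         ≤⟨ *-monoʳ-≤ (ℚ.nonNegative⁻¹ q) (subst (_≤ ι (suc d)) ι-1 (ι-mono-≤ (ℕ.s≤s ℕ.z≤n))) ⟩
  q * ι (suc d)                  ≡⟨ cong (_* ι (suc d)) (ℚ.↥p/↧p≡p q) ⟨
  (+ p / suc d) * ι (suc d)      ≡⟨ /-*-ι p (suc d) ⟩
  ι p                            ∎)
  where open ℚ.≤-Reasoning

a-ε<a : ∀ a {ε} → 0ℚ < ε → a - ε < a
a-ε<a a {ε} 0<ε = subst (a - ε <_) (ℚ.+-identityʳ a) (ℚ.+-monoʳ-< a (ℚ.neg-antimono-< 0<ε))

-- For r = p/Q with p ≥ 0, r < 1/4 is the integer inequality 4p + 1 ≤ Q. A negative exponent is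
-- relaxed to p = 0.
^ℤ-bound : ∀ n .{{_ : NonZero n}} r → r < + 1 / 4 →
           ∃[ p ] (suc (p ℕ.* 4) ℕ.≤ ↧ₙ r × n ^ℤ (↥ r) ≤ ι (n ℕ.^ p))
^ℤ-bound n (mkℚ (+ p) d _) (*<* p4<Q) =
  p , subst (p ℕ.* 4 ℕ.<_) (ℕ.*-identityˡ (suc d))
        (ℤ.drop‿+<+ (subst₂ ℤ._<_ (sym (ℤ.pos-* p 4)) (sym (ℤ.pos-* 1 (suc d))) p4<Q))
    , ℚ.≤-reflexive (ι-def (n ℕ.^ p))
^ℤ-bound n (mkℚ -[1+ p ] d _) _ = 0 , ℕ.s≤s ℕ.z≤n , *-cancelʳ-≤ (0<ι N) (begin
  (+ 1 / N) * ι N    ≡⟨ /-*-ι 1 N ⟩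
  ι 1                ≤⟨ ι-mono-≤ (ℕ.>-nonZero⁻¹ N) ⟩
  ι N                ≡⟨ ℚ.*-identityˡ (ι N) ⟨
  1ℚ * ι N           ≡⟨ cong (_* ι N) ι-1 ⟨
  ι 1 * ι N          ∎)
  where
  open ℚ.≤-Reasoning
  N = n ℕ.^ suc p
  instance
    N≢0 : NonZero N
    N≢0 = ℕ.m^n≢0 n (suc p)

-- The hypothesis k/h ≤ K n^(1/4 − ε), cleared of fractions and roots.
k/h-bound : ∀ {K ε} κ → 0ℚ < K → K ≤ ι κ → 0ℚ < ε → let Q = ↧ₙ ((+ 1 / 4) - ε) in
  ∀ n .{{_ : NonZero n}} k h .{{_ : NonZero h}} →
  (+ k / h) ≤[ K · n ^ (+ 1 / 4) - ε ] →
  n ℕ.* (k ℕ.^ 4) ℕ.^ Q ℕ.≤ ((κ ℕ.* h) ℕ.^ 4 ℕ.* n) ℕ.^ Q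
k/h-bound {K} {ε} κ 0<K K≤κ 0<ε n k h k/h≤
  with p , 4p<Q , n^r≤n^p ← ^ℤ-bound n ((+ 1 / 4) - ε) (a-ε<a (+ 1 / 4) 0<ε) = begin
  n ℕ.* (k ℕ.^ 4) ℕ.^ Q
    ≡⟨ cong (n ℕ.*_) (^-swap k 4 Q) ⟩
  n ℕ.* (k ℕ.^ Q) ℕ.^ 4
    ≤⟨ ℕ.*-monoʳ-≤ n (ℕ.^-monoˡ-≤ 4 k^Q≤) ⟩
  n ℕ.* ((κ ℕ.* h) ℕ.^ Q ℕ.* n ℕ.^ p) ℕ.^ 4
    ≡⟨ cong (n ℕ.*_) (trans (ℕ-^-distribʳ-* ((κ ℕ.* h) ℕ.^ Q) (n ℕ.^ p) 4)
         (cong₂ ℕ._*_ (^-swap (κ ℕ.* h) Q 4) (ℕ.^-*-assoc n p 4))) ⟩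
  n ℕ.* (((κ ℕ.* h) ℕ.^ 4) ℕ.^ Q ℕ.* n ℕ.^ (p ℕ.* 4))
    ≡⟨ ℕ-Solver.solve 3 (λ n a b → n ⊛ (a ⊛ b) ≐ a ⊛ (n ⊛ b)) refl n (((κ ℕ.* h) ℕ.^ 4) ℕ.^ Q) (n ℕ.^ (p ℕ.* 4)) ⟩
  ((κ ℕ.* h) ℕ.^ 4) ℕ.^ Q ℕ.* n ℕ.^ suc (p ℕ.* 4)
    -- Here ε > 0 pays off: 4p < Q leaves room for the extra factor n, the gain that becomes k² ≤
    -- n^(1 - 1/Q).
    ≤⟨ ℕ.*-monoʳ-≤ (((κ ℕ.* h) ℕ.^ 4) ℕ.^ Q) (ℕ.^-monoʳ-≤ n 4p<Q) ⟩
  ((κ ℕ.* h) ℕ.^ 4) ℕ.^ Q ℕ.* n ℕ.^ Q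
    ≡⟨ ℕ-^-distribʳ-* ((κ ℕ.* h) ℕ.^ 4) n Q ⟨
  ((κ ℕ.* h) ℕ.^ 4 ℕ.* n) ℕ.^ Q ∎
  where
  open ℕ.≤-Reasoning
  Q = ↧ₙ ((+ 1 / 4) - ε)
  k^Q≤ : k ℕ.^ Q ℕ.≤ (κ ℕ.* h) ℕ.^ Q ℕ.* n ℕ.^ p
  k^Q≤ = ι-cancel-≤ (R.begin
    ι (k ℕ.^ Q)                             R.≡⟨ trans (ι-^ k Q) (trans (cong (_^ Q) (sym (/-*-ι k h))) (^-distrib-* (+ k / h) (ι h) Q)) ⟩
    (+ k / h) ^ Q * ι h ^ Q                 R.≤⟨ *-monoˡ-≤ (0≤^ Q (0≤ι h)) (ℚ.≤-trans k/h≤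
      (*-mono-≤ (0≤^ Q (ℚ.<⇒≤ 0<K)) (0≤ι (n ℕ.^ p)) (^-monoˡ-≤ Q (ℚ.<⇒≤ 0<K) K≤κ) n^r≤n^p)) ⟩
    ι κ ^ Q * ι (n ℕ.^ p) * ι h ^ Q         R.≡⟨ solve 3 (λ a b c → a :* b :* c := a :* c :* b) refl (ι κ ^ Q) (ι (n ℕ.^ p)) (ι h ^ Q) ⟩
    ι κ ^ Q * ι h ^ Q * ι (n ℕ.^ p)         R.≡⟨ cong (_* ι (n ℕ.^ p)) (trans (sym (^-distrib-* (ι κ) (ι h) Q)) (trans (cong (_^ Q) (sym (ι-* κ h))) (sym (ι-^ (κ ℕ.* h) Q)))) ⟩
    ι ((κ ℕ.* h) ℕ.^ Q) * ι (n ℕ.^ p)       R.≡⟨ ι-* ((κ ℕ.* h) ℕ.^ Q) (n ℕ.^ p) ⟨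
    ι ((κ ℕ.* h) ℕ.^ Q ℕ.* n ℕ.^ p)         R.∎)
    where module R = ℚ.≤-Reasoning

t<threshold : ∀ g .{{_ : NonZero (2 ℕ.* g)}} k h .{{_ : NonZero (h ℕ.^ 2)}} t →
  ¬ ((+ 1 / (2 ℕ.* g)) * (+ k / (h ℕ.^ 2)) ≤ + t / 1) → t ℕ.* g ℕ.* (2 ℕ.* (h ℕ.* h)) ℕ.< k
t<threshold g k h t t<b = ι-cancel-< (begin-strict
  ι (t ℕ.* g ℕ.* (2 ℕ.* (h ℕ.* h)))
    ≡⟨ cong ι (ℕ-Solver.solve 3 (λ t g h → t ⊛ g ⊛ (lit 2 ⊛ (h ⊛ h)) ≐ t ⊛ (lit 2 ⊛ g ⊛ (h ⊛ (h ⊛ lit 1)))) refl t g h) ⟩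
  ι (t ℕ.* (2 ℕ.* g ℕ.* h ℕ.^ 2))
    ≡⟨ trans (ι-* t (2 ℕ.* g ℕ.* h ℕ.^ 2)) (cong (ι t *_) (ι-* (2 ℕ.* g) (h ℕ.^ 2))) ⟩
  ι t * (ι (2 ℕ.* g) * ι (h ℕ.^ 2))
    <⟨ ℚ.*-monoˡ-<-pos (ι (2 ℕ.* g) * ι (h ℕ.^ 2)) {{ℚ.positive (0<*0<⇒0< (0<ι (2 ℕ.* g)) (0<ι (h ℕ.^ 2)))}}
         (subst (_< u * v) (ι-def t) (ℚ.≰⇒> t<b)) ⟩
  u * v * (ι (2 ℕ.* g) * ι (h ℕ.^ 2))
    ≡⟨ solve 4 (λ u v a b → u :* v :* (a :* b) := u :* a :* (v :* b)) refl u v (ι (2 ℕ.* g)) (ι (h ℕ.^ 2)) ⟩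
  u * ι (2 ℕ.* g) * (v * ι (h ℕ.^ 2))
    ≡⟨ cong₂ _*_ (trans (/-*-ι 1 (2 ℕ.* g)) ι-1) (/-*-ι k (h ℕ.^ 2)) ⟩
  1ℚ * ι k
    ≡⟨ ℚ.*-identityˡ (ι k) ⟩
  ι k ∎)
  where
  open ℚ.≤-Reasoning
  u = + 1 / (2 ℕ.* g)
  v = + k / (h ℕ.^ 2)

-- The exponent -1 has denominator 1, so the encoded comparison involves only first powers.
≤[1·n^-1] : ∀ n .{{_ : NonZero n}} x → x * ι n ≤ 1ℚ → x ≤[ 1ℚ · n ^ - 1ℚ ]
≤[1·n^-1] n x xn≤1 = *-cancelʳ-≤ (0<ι N) (begin
  x * 1ℚ * ι N                    ≡⟨ cong₂ _*_ (ℚ.*-identityʳ x) (cong ι (ℕ.*-identityʳ n)) ⟩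
  x * ι n                         ≤⟨ xn≤1 ⟩
  1ℚ                              ≡⟨ trans (/-*-ι 1 N) ι-1 ⟨
  (+ 1 / N) * ι N                 ≡⟨ cong (_* ι N) (ℚ.*-identityˡ (+ 1 / N)) ⟨
  1ℚ * (+ 1 / N) * ι N            ∎)
  where
  open ℚ.≤-Reasoning
  N = n ℕ.^ 1
  instance
    N≢0 : NonZero N
    N≢0 = ℕ.m^n≢0 n 1

theorem4p12 : (ε K : ℚ) → 0ℚ < ε → 0ℚ < K →
    ∃[ γ ] ∃[ α ] ∃[ n₀ ] (0ℚ < γ) × (0ℚ < α) ×
    (∀ (n : ℕ) .{{_ : NonZero n}} → n₀ ℕ.≤ n →
    ∀ (k h : ℕ) .{{_ : NonZero h}} → 2 ℕ.≤ k →
    (+ k / h) ≤[ K · n ^ (+ 1 / 4) - ε ] →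
    ∀ (c : Vec ℕ k) → sum c ≡ n →
    2 ℕ.* k ℕ.* maximum c ℕ.≤ 3 ℕ.* n →
    ∀ (x : Colouring n k) → configuration x ≡ c →
    ∀ (T : ℕ) →
    let threshold = γ * (+ k / (h ℕ.^ 2)) {{m^n≢0 h 2}} in
    (1ℚ - Pr (trajectory h x T) (τ≥? n threshold)) ≤[ 1ℚ · n ^ - α ])
theorem4p12 ε K 0<ε 0<K =
  let κ , K≤κ = archimedean K
      Q = ↧ₙ ((+ 1 / 4) - ε)
      -- When g ≤ R, the summand 8 yields R ≥ 8 and 4N ≤ R, and κ² yields κ²h² ≤ k.
      g = 8 ℕ.+ κ ℕ.* κ
  in
  -- γ = 1/(2g): the 2 matches R = ⌊k/(2h²)⌋, so that t < γk/h² implies tg ≤ R.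
  + 1 / (2 ℕ.* g) , 1ℚ , minimalSize Q , ℚ.positive⁻¹ (+ 1 / (2 ℕ.* g)) {{ℚ.normalize-pos 1 (2 ℕ.* g)}} , 0<1 ,
  λ n n-large k h 2≤k k/h≤ _ _ balanced x x≡c T →
    let instance _ = m^n≢0 h 2
        threshold = (+ 1 / (2 ℕ.* g)) * (+ k / (h ℕ.^ 2))
    in
    ≤[1·n^-1] n (1ℚ - Pr (trajectory h x T) (τ≥? n threshold))
      (1-Pr[τ≥]*n≤1 g κ Q (ℕ.m≤m+n 8 (κ ℕ.* κ)) (ℕ.m≤n+m (κ ℕ.* κ) 8) n-large 2≤k
        (k/h-bound κ 0<K K≤κ 0<ε n k h k/h≤)
        x (subst (λ c → 2 ℕ.* k ℕ.* maximum c ℕ.≤ 3 ℕ.* n) (sym x≡c) balanced) T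
        threshold (t<threshold g k h))
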